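{- Let $R$ and $T$ be non-trivial transitive permutation groups, let $m$ be the degree of $R$ and let $T_\omega$ be a point-stabiliser in $T$. Then the imprimitive wreath product $R\wr T$ is $f$-graph-unrestrictive, where $f(n)=\frac{|T_\omega|^2|R|^{n/m}}{m^2}$. In particular, $R\wr T$ has graph-type $\mathrm{Exp}$.
   Context: All graphs are finite, simple and connected. For a graph $\Gamma$, a vertex $v$ and $G\le \mathrm{Aut}(\Gamma)$, $G_v^{\Gamma(v)}$ is the permutation group induced by $G_v$ on the neighbourhood $\Gamma(v)$. A pair $(\Gamma,G)$ with $G\le\mathrm{Aut}(\Gamma)$ is locally-$L$ if $G$ is transitive on the arcs of $\Gamma$ and $G_v^{\Gamma(v)}$ is permutation isomorphic to $L$. For $f:\mathbb N\to\mathbb R$, a transitive permutation group $L$ is $f$-graph-restrictive if $|G_{uv}|\le f(|\mathrm V(\Gamma)|)$ for every locally-$L$ pair $(\Gamma,G)$ and arc $(u,v)$; it is $f$-graph-unrestrictive if for every integer $n$ there is a locally-$L$ pair $(\Gamma,G)$ with $|\mathrm V(\Gamma)|\ge n$ and $|G_{uv}|\ge f(|\mathrm V(\Gamma)|)$ for an arc $(u,v)$. For a class $\mathcal C$ of functions, $L$ is $\mathcal C$-graph-(un)restrictive if it is $f$-graph-(un)restrictive for some $f\in\mathcal C$, and $L$ has graph-type $\mathcal C$ if it is both. $\mathrm{Exp}$ is the class of functions $f(n)=\alpha^n$ with $\alpha>1$. The imprimitive wreath product $R\wr T$ ($R$ on $\Delta$, $T$ on $\Omega=\{1,\dots,k\}$)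 is $R^k\rtimes T$ acting on $\Delta\times\Omega$ by $(\delta,\omega)^{(a_1,\dots,a_k)}=(\delta^{a_\omega},\omega)$ and $(\delta,\omega)^b=(\delta,\omega^b)$. -}

module Defs where

open import Data.Nat using (ℕ; zero; suc; _+_; _*_; _^_; _≤_; _<_)
open import Data.Fin using (Fin)
open import Data.Fin.Properties using (_≟_)
open import Data.Bool using (Bool; true; false)
open import Data.Vec using (Vec; lookup; tabulate; allFin)
open import Data.List using (List; []; _∷_; length)
open import Data.List.Membership.Propositional using (_∈_)
open import Data.List.Relation.Unary.All using (All)
open import Data.List.Relation.Unary.Unique.Propositional using (Unique)
open import Data.Product using (Σ; _×_; _,_; ∃)
open import Relation.Nullary using (yes; no)
open import Relation.Binary.PropositionalEquality using (_≡_)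

-- Permutations of Fin n, stored as their table of images (decidable
-- equality is then propositional equality).  Right action: i ^ p.

Perm : ℕ → Set
Perm n = Vec (Fin n) n

app : ∀ {n} → Perm n → Fin n → Fin n
app p i = lookup p i

comp : ∀ {n} → Perm n → Perm n → Perm n
comp p q = tabulate (λ i → lookup q (lookup p i))

idPerm : ∀ {n} → Perm n
idPerm {n} = allFin n

IsPerm : ∀ {n} → Perm n → Set
IsPerm {n} p = ∀ (i j : Fin n) → app p i ≡ app p j → i ≡ j

-- A (finite) permutation group of degree n: a duplicate-free list of
-- permutations of Fin n, containing the identity, closed under composition.
-- (A nonempty finite set of permutations closed under composition is a group.)
record PermGroup (n : ℕ) : Set where
  field
    elems  : List (Perm n)
    unique : Unique elems
    perms  : All IsPerm elems
    hasId  : idPerm ∈ elems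
    closed : ∀ {p q} → p ∈ elems → q ∈ elems → comp p q ∈ elems
open PermGroup public

order : ∀ {n} → PermGroup n → ℕ
order G = length (elems G)

Transitive : ∀ {n} → PermGroup n → Set
Transitive {n} G = ∀ (i j : Fin n) → Σ (Perm n) λ p → p ∈ elems G × app p i ≡ j

countFix2 : ∀ {n} → List (Perm n) → Fin n → Fin n → ℕ
countFix2 [] u v = 0
countFix2 (p ∷ ps) u v with app p u ≟ u | app p v ≟ v
... | yes _ | yes _ = suc (countFix2 ps u v)
... | _     | _     = countFix2 ps u v

stabOrder : ∀ {n} → PermGroup n → Fin n → ℕ
stabOrder G ω = countFix2 (elems G) ω ω

stab2Order : ∀ {n} → PermGroup n → Fin n → Fin n → ℕ
stab2Order G u v = countFix2 (elems G) u v

data Walk {N : ℕ} (adj : Fin N → Fin N → Bool) : Fin N → Fin N → Set where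
  here : ∀ {u} → Walk adj u u
  step : ∀ {u w v} → adj u w ≡ true → Walk adj w v → Walk adj u v

record Graph (N : ℕ) : Set where
  field
    adj       : Fin N → Fin N → Bool
    symmetric : ∀ u v → adj u v ≡ adj v u
    irreflex  : ∀ u → adj u u ≡ false
    nonempty  : 0 < N
    connected : ∀ u v → Walk adj u v
open Graph public

IsAutGroup : ∀ {N} → Graph N → PermGroup N → Set
IsAutGroup {N} Γ G =
  ∀ g → g ∈ elems G → ∀ (u v : Fin N) → adj Γ (app g u) (app g v) ≡ adj Γ u v

ArcTransitive : ∀ {N} → Graph N → PermGroup N → Set
ArcTransitive {N} Γ G = ∀ (u v x y : Fin N) → adj Γ u v ≡ true → adj Γ x y ≡ true →
  Σ (Perm N) λ g → g ∈ elems G × app g u ≡ x × app g v ≡ y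

-- G_v^{Γ(v)} is permutation isomorphic to the permutation group L on the
-- point set X, where L is given by its membership predicate InL on maps X → X:
-- there is a bijection β : X → Γ(v) such that the permutations induced by G_v
-- on Γ(v) are exactly the β-conjugates of the elements of L.
LocalActionIso : ∀ {N} → Graph N → PermGroup N → Fin N →
                 (X : Set) → ((X → X) → Set) → Set
LocalActionIso {N} Γ G v X InL =
  Σ (X → Fin N) λ β →
    (∀ x y → β x ≡ β y → x ≡ y) ×
    (∀ x → adj Γ v (β x) ≡ true) ×
    (∀ w → adj Γ v w ≡ true → Σ X λ x → β x ≡ w) ×
    (∀ g → g ∈ elems G → app g v ≡ v →
       Σ (X → X) λ ℓ → InL ℓ × (∀ x → app g (β x) ≡ β (ℓ x))) ×
    (∀ ℓ → InL ℓ →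
       Σ (Perm N) λ g → g ∈ elems G × app g v ≡ v × (∀ x → app g (β x) ≡ β (ℓ x)))

LocallyL : ∀ {N} → Graph N → PermGroup N → (X : Set) → ((X → X) → Set) → Set
LocallyL {N} Γ G X InL =
  IsAutGroup Γ G × ArcTransitive Γ G × (∀ v → LocalActionIso Γ G v X InL)

InWreath : ∀ {m k} → PermGroup m → PermGroup k → (Fin m × Fin k → Fin m × Fin k) → Set
InWreath {m} {k} R T σ =
  Σ (Fin k → Perm m) λ a → Σ (Perm k) λ b →
    (∀ ω → a ω ∈ elems R) × b ∈ elems T ×
    (∀ δ ω → σ (δ , ω) ≡ (app (a ω) δ , app b ω))

-- L is Exp-graph-restrictive: |G_uv| ≤ α^n for some α > 1.  It suffices (and
-- is equivalent) to take α = p/q rational, p > q ≥ 1.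
ExpRestrictive : (X : Set) → ((X → X) → Set) → Set
ExpRestrictive X InL =
  Σ ℕ λ p → Σ ℕ λ q → 0 < q × q < p ×
    (∀ N (Γ : Graph N) (G : PermGroup N) → LocallyL Γ G X InL →
       ∀ u v → adj Γ u v ≡ true → stab2Order G u v * q ^ N ≤ p ^ N)

-- L is Exp-graph-unrestrictive: for some α > 1 (equivalently rational p/q),
-- arbitrarily large locally-L pairs with |G_uv| ≥ α^n.
ExpUnrestrictive : (X : Set) → ((X → X) → Set) → Set
ExpUnrestrictive X InL =
  Σ ℕ λ p → Σ ℕ λ q → 0 < q × q < p ×
    (∀ n₀ → Σ ℕ λ N → Σ (Graph N) λ Γ → Σ (PermGroup N) λ G →
       LocallyL Γ G X InL × n₀ ≤ N ×
       Σ (Fin N) λ u → Σ (Fin N) λ v → adj Γ u v ≡ true ×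
         p ^ N ≤ stab2Order G u v * q ^ N)

GraphTypeExp : (X : Set) → ((X → X) → Set) → Set
GraphTypeExp X InL = ExpRestrictive X InL × ExpUnrestrictive X InL

-- L is f-graph-unrestrictive for f(n) = a^2 * r^(n/m) / m^2, written without
-- division/roots: f(N) ≤ |G_uv|  ⇔  a^(2m) * r^N ≤ |G_uv|^m * m^(2m)  (m ≥ 1).
UnrestrictiveWreathBound : (X : Set) → ((X → X) → Set) → (a r m : ℕ) → Set
UnrestrictiveWreathBound X InL a r m =
  ∀ n₀ → Σ ℕ λ N → Σ (Graph N) λ Γ → Σ (PermGroup N) λ G →
    LocallyL Γ G X InL × n₀ ≤ N ×
    Σ (Fin N) λ u → Σ (Fin N) λ v → adj Γ u v ≡ true ×
      a ^ (2 * m) * r ^ N ≤ stab2Order G u v ^ m * m ^ (2 * m)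

{-# OPTIONS --safe #-}
module Submission where

-- Let Λ be a connected graph of valency k with an arc-transitive group whose vertex stabilisers
-- are T × T_ω, the factor T acting on the neighbourhood.  In the lexicographic product of Λ with m
-- isolated vertices every fibre carries its own copy of R, so an arc stabiliser has order at least
-- |T_ω|² |R|^n / m², where n is the order of Λ.  The complete bipartite graph K_{k,k} has the
-- required group; arbitrarily large Λ are the connected components of its covers with voltages in
-- ℤₙ^{k×k}, to which all of (T × T) ⋊ 2 lifts.
-- Conversely, in a connected graph an automorphism fixing a vertex is determined by the
-- permutations of labels it induces at all vertices, so vertex stabilisers are at most
-- exponentially large.

open import Defs

open import Algebra.Bundles using (AbelianGroup)
import Algebra.Properties.AbelianGroup as AbelianGroupₚ
open import Data.Bool using (Bool; true; false; not; _xor_; _∧_; if_then_else_)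
open import Data.Bool.Properties as Boolₚ using (∧-comm; ∧-zeroʳ; not-involutive)
open import Data.Fin using (Fin; zero; suc; toℕ; fromℕ<; punchOut; combine; remQuot; funToFin; finToFun)
open import Data.Fin.Properties as Finₚ
  using (all?; any?; combine-injective; combine-remQuot; remQuot-combine; finToFun-funToFin;
         funToFin-finToFin; injective⇒≤; punchOut-injective; toℕ-fromℕ<; toℕ-injective; toℕ<n)
open import Data.List as List using (List; []; _∷_; length; filter; cartesianProduct; cartesianProductWith)
open import Data.List.Membership.Propositional using (_∈_; find; lose)
open import Data.List.Membership.Propositional.Properties
  using (∈-lookup; ∈-filter⁺; ∈-filter⁻; ∈-cartesianProduct⁺; ∈-cartesianProductWith⁺; ∈-allFin)
open import Data.List.Relation.Unary.All as All using ([]; _∷_)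
open import Data.List.Relation.Unary.AllPairs using ([]; _∷_)
open import Data.List.Relation.Unary.Any as Any using (Any; here; there)
open import Data.List.Relation.Unary.Any.Properties using (lookup-index)
open import Data.List.Relation.Unary.Unique.Propositional using (Unique)
import Data.List.Relation.Unary.Unique.Propositional.Properties as Uniqueₚ
open import Data.Nat
  using (ℕ; zero; suc; _+_; _*_; _∸_; _^_; _⊔_; _≤_; _<_; z≤n; s≤s; NonZero; >-nonZero)
open import Data.Nat.DivMod using (_%_; _mod_; m%n<n; m<n⇒m%n≡m; %-distribˡ-+; n%n≡0)
open import Data.Nat.Properties as ℕₚ hiding (_≟_)
open import Data.Nat.Tactic.RingSolver using (solve-∀)
open import Data.Product using (Σ; ∃; ∃₂; _×_; _,_; proj₁; proj₂; uncurry)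
open import Data.Product.Properties using (,-injective; ≡-dec)
open import Data.Sum using (_⊎_; inj₁; inj₂)
open import Data.Vec using (Vec; []; _∷_; lookup; tabulate)
open import Data.Vec.Properties as Vecₚ using (lookup∘tabulate; tabulate∘lookup; tabulate-cong)
open import Function using (_∘_; id; mk⇔)
open import Relation.Binary.Construct.Closure.ReflexiveTransitive
  using (Star; ε; _◅_; _◅◅_; gmap; reverse; return)
open import Relation.Binary.Definitions using (DecidableEquality)
open import Relation.Binary.PropositionalEquality
open import Relation.Nullary using (Dec; yes; no; does; contradiction)
open import Relation.Nullary.Decidable
  using (_×-dec_; _⊎-dec_; _→-dec_; map′; does-⇔; dec-true; dec-false)
open import Relation.Unary using (Decidable)


-- Finite sets and counting

-- The base graph has to grow while every automorphism with prescribed action around a vertex and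
-- around its neighbours survives. Giving each edge of K_{k,k} its own voltage coordinate achieves
-- both: an automorphism of K_{k,k} only permutes the coordinates, with a sign when the sides are
-- exchanged, so it lifts, and the translations of the voltages are automorphisms as well. On the
-- lexicographic product no semidirect product is formed. The group consists of all permutations
-- that act at every vertex as an element of R≀T. It is closed for formal reasons and its local
-- action cannot be too large, so only the existence of enough elements has to be shown. They come
-- from automorphisms of Λ combined with an arbitrary element of R on each fibre. The two factors
-- |T_ω| arise because the labels around the two ends of an arc can be permuted independently. The
-- divisor m² arises because an element of R on the fibre of an end may send that end to any of m
-- points, and there are two ends.

lookup-injective : ∀ {A : Set} {xs : List A} → Unique xs →
                   ∀ {i j} → List.lookup xs i ≡ List.lookup xs j → i ≡ j
lookup-injective {xs = _ ∷ _} _ {zero} {zero} _ = refl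
lookup-injective {xs = _ ∷ _} (x∉ ∷ _) {zero} {suc j} eq =
  contradiction eq (All.lookup x∉ (∈-lookup j))
lookup-injective {xs = _ ∷ _} (x∉ ∷ _) {suc i} {zero} eq =
  contradiction (sym eq) (All.lookup x∉ (∈-lookup i))
lookup-injective {xs = _ ∷ _} (_ ∷ uniq) {suc i} {suc j} eq =
  cong suc (lookup-injective uniq eq)

lookup-index-∈ : ∀ {A : Set} {x : A} {xs} (x∈ : x ∈ xs) → List.lookup xs (Any.index x∈) ≡ x
lookup-index-∈ x∈ = sym (lookup-index x∈)

length-≤-injective : ∀ {A : Set} {xs : List A} {n} → Unique xs → (f : A → Fin n) →
  (∀ {x y} → x ∈ xs → y ∈ xs → f x ≡ f y → x ≡ y) → length xs ≤ n
length-≤-injective {xs = xs} uniq f f-inj =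
  injective⇒≤ {f = λ i → f (List.lookup xs i)}
    (λ eq → lookup-injective uniq (f-inj (∈-lookup _) (∈-lookup _) eq))

index-cancel : ∀ {A : Set} {xs : List A} {x y} (x∈ : x ∈ xs) (y∈ : y ∈ xs) →
               Any.index x∈ ≡ Any.index y∈ → x ≡ y
index-cancel {xs = xs} x∈ y∈ eq =
  trans (lookup-index x∈) (trans (cong (List.lookup xs) eq) (sym (lookup-index y∈)))

-- A missed point could be punched out, which would inject `Fin (suc n)` into `Fin n`. This supplies
-- the inverses of group elements as functions, since `PermGroup` records none.
fin-injective⇒surjective : ∀ {n} {f : Fin n → Fin n} → (∀ i j → f i ≡ f j → i ≡ j) →
                       ∀ j → ∃ λ i → f i ≡ j
fin-injective⇒surjective {suc n} {f} f-inj j with any? (λ i → f i Finₚ.≟ j)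
... | yes hit = hit
... | no miss = contradiction
  (injective⇒≤ {f = λ i → punchOut (avoid i)}
    (λ eq → f-inj _ _ (punchOut-injective (avoid _) (avoid _) eq)))
  (ℕₚ.<⇒≱ ≤-refl)
  where
  avoid : ∀ i → j ≢ f i
  avoid i eq = miss (i , sym eq)

record Enumeration (A : Set) : Set where
  field
    elements : List A
    distinct : Unique elements
    complete : ∀ x → x ∈ elements
open Enumeration

enumBool : Enumeration Bool
enumBool = record
  { elements = true ∷ false ∷ []
  ; distinct = ((λ ()) ∷ []) ∷ [] ∷ []
  ; complete = λ { true → here refl ; false → there (here refl) }
  }

enumFin : ∀ n → Enumeration (Fin n)
enumFin n = record
  { elements = List.allFin n ; distinct = Uniqueₚ.allFin⁺ n ; complete = ∈-allFin }

enum× : ∀ {A B} → Enumeration A → Enumeration B → Enumeration (A × B)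
enum× a b = record
  { elements = cartesianProduct (elements a) (elements b)
  ; distinct = Uniqueₚ.cartesianProduct⁺ (distinct a) (distinct b)
  ; complete = λ { (x , y) → ∈-cartesianProduct⁺ (complete a x) (complete b y) }
  }

enumVec : ∀ {A} → Enumeration A → ∀ n → Enumeration (Vec A n)
enumVec a zero = record
  { elements = [] ∷ [] ; distinct = [] ∷ [] ; complete = λ { [] → here refl } }
enumVec a (suc n) = record
  { elements = cartesianProductWith _∷_ (elements a) (elements (enumVec a n))
  ; distinct = Uniqueₚ.cartesianProductWith⁺ _∷_ (λ { refl → refl , refl })
                 (distinct a) (distinct (enumVec a n))
  ; complete = λ { (x ∷ xs) → ∈-cartesianProductWith⁺ _∷_ (complete a x) (complete (enumVec a n) xs) }
  }

-- Permutation groups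

lookup-ext : ∀ {A : Set} {n} {p q : Vec A n} → (∀ i → lookup p i ≡ lookup q i) → p ≡ q
lookup-ext {p = p} {q} eq =
  trans (sym (tabulate∘lookup p)) (trans (tabulate-cong eq) (tabulate∘lookup q))

app-comp : ∀ {n} (p q : Perm n) i → app (comp p q) i ≡ app q (app p i)
app-comp p q i = lookup∘tabulate _ i

app-id : ∀ {n} (i : Fin n) → app idPerm i ≡ i
app-id i = lookup∘tabulate id i

module _ {n} (G : PermGroup n) where

  ∈-isPerm : ∀ {p} → p ∈ elems G → IsPerm p
  ∈-isPerm = All.lookup (perms G)

  element : Fin (order G) → Perm n
  element = List.lookup (elems G)

  -- Non-triviality is assumed as a bound on the order, whereas the construction uses points: two
  -- different labels for a 4-cycle in K_{k,k}, and a base point for the fibres.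
  degree>1 : 1 < order G → 1 < n
  degree>1 1<o = ℕₚ.≰⇒> λ n≤1 → ℕₚ.<⇒≱ 1<o
    (length-≤-injective (unique G) (λ _ → zero {0}) (λ _ _ _ → lookup-ext λ i → fin-subsingleton n≤1 _ _))
    where
    fin-subsingleton : ∀ {n} → n ≤ 1 → (i j : Fin n) → i ≡ j
    fin-subsingleton (s≤s z≤n) zero zero = refl

Fixes₂ : ∀ {n} → Fin n → Fin n → Perm n → Set
Fixes₂ u v p = app p u ≡ u × app p v ≡ v

fixes₂? : ∀ {n} (u v : Fin n) → Decidable (Fixes₂ u v)
fixes₂? u v p = (app p u Finₚ.≟ u) ×-dec (app p v Finₚ.≟ v)

countFix2≡ : ∀ {n} (ps : List (Perm n)) u v → countFix2 ps u v ≡ length (filter (fixes₂? u v) ps)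
countFix2≡ [] u v = refl
countFix2≡ (p ∷ ps) u v with app p u Finₚ.≟ u | app p v Finₚ.≟ v
... | yes _ | yes _ = cong suc (countFix2≡ ps u v)
... | yes _ | no _  = countFix2≡ ps u v
... | no _  | _     = countFix2≡ ps u v

stabiliser : ∀ {n} → PermGroup n → Fin n → Fin n → List (Perm n)
stabiliser G u v = filter (fixes₂? u v) (elems G)

module _ {n} (G : PermGroup n) (u v : Fin n) where

  stabiliser-element : Fin (stab2Order G u v) → Perm n
  stabiliser-element i =
    List.lookup (stabiliser G u v) (subst Fin (countFix2≡ (elems G) u v) i)

  stabiliser-element∈ : ∀ i → stabiliser-element i ∈ elems G × Fixes₂ u v (stabiliser-element i)
  stabiliser-element∈ i = ∈-filter⁻ (fixes₂? u v) {xs = elems G} (∈-lookup (subst Fin _ i))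

  stabiliser-element-injective : ∀ {i j} → stabiliser-element i ≡ stabiliser-element j → i ≡ j
  stabiliser-element-injective eq =
    subst-injective (countFix2≡ (elems G) u v)
      (lookup-injective (Uniqueₚ.filter⁺ (fixes₂? u v) (unique G)) eq)

  stabiliser-index : ∀ {p} → p ∈ elems G → Fixes₂ u v p → Fin (stab2Order G u v)
  stabiliser-index p∈ fix = subst Fin (sym (countFix2≡ (elems G) u v))
    (Any.index (∈-filter⁺ (fixes₂? u v) p∈ fix))

  stabiliser-index-cancel : ∀ {p q} (p∈ : p ∈ elems G) (q∈ : q ∈ elems G) fixp fixq →
    stabiliser-index p∈ fixp ≡ stabiliser-index q∈ fixq → p ≡ q
  stabiliser-index-cancel p∈ q∈ fixp fixq eq =
    index-cancel (∈-filter⁺ (fixes₂? u v) p∈ fixp) (∈-filter⁺ (fixes₂? u v) q∈ fixq)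
      (subst-injective (sym (countFix2≡ (elems G) u v)) eq)

funToFin-injective : ∀ {m n} {f g : Fin m → Fin n} → funToFin f ≡ funToFin g → ∀ i → f i ≡ g i
funToFin-injective {f = f} {g} eq i =
  trans (sym (finToFun-funToFin f i)) (trans (cong (λ h → finToFun h i) eq) (finToFun-funToFin g i))

-- The exponential upper bound

module _ {m k N} {InL} (Γ : Graph N) (G : PermGroup N)
         (locally : LocallyL Γ G (Fin m × Fin k) InL) where

  private
    aut = proj₁ locally

    β : Fin N → Fin m × Fin k → Fin N
    β v = proj₁ (proj₂ (proj₂ locally) v)

    β-adj : ∀ v x → adj Γ v (β v x) ≡ true
    β-adj v = proj₁ (proj₂ (proj₂ (proj₂ (proj₂ locally) v)))

    label : ∀ v w → adj Γ v w ≡ true → Σ (Fin m × Fin k) λ x → β v x ≡ w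
    label v = proj₁ (proj₂ (proj₂ (proj₂ (proj₂ (proj₂ locally) v))))

  -- An element is coded by recording, for each vertex `w` and each label of a neighbour of `w`, the
  -- label of the image of that neighbour around the image of `w`. Two elements with the same code
  -- agree at `u`, and agreement spreads along walks from `u`.
  stab2Order-≤ : ∀ u v → stab2Order G u v ≤ ((m * k) ^ (m * k)) ^ N
  stab2Order-≤ u v = injective⇒≤ {f = λ i → funToFin (λ w → funToFin (λ y → code i w y))} λ {i} {j} eq →
    stabiliser-element-injective G u v
      (lookup-ext λ w → agree (λ x y → funToFin-injective (funToFin-injective eq x) y) (connected Γ u w)
        (trans (fixes i) (sym (fixes j))))
    where
    g : Fin (stab2Order G u v) → Fin N → Fin N
    g i = app (stabiliser-element G u v i)

    fixes : ∀ i → g i u ≡ u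
    fixes i = proj₁ (proj₂ (stabiliser-element∈ G u v i))

    g-adj : ∀ i {x y} → adj Γ x y ≡ true → adj Γ (g i x) (g i y) ≡ true
    g-adj i x~y = trans (aut _ (proj₁ (stabiliser-element∈ G u v i)) _ _) x~y

    local : ∀ i w y → Σ (Fin m × Fin k) λ x → β (g i w) x ≡ g i (β w (remQuot k y))
    local i w y = label _ _ (g-adj i (β-adj w (remQuot k y)))

    code : ∀ i → Fin N → Fin (m * k) → Fin (m * k)
    code i w y = uncurry combine (proj₁ (local i w y))

    code-injective : ∀ {i j} w y → code i w y ≡ code j w y → proj₁ (local i w y) ≡ proj₁ (local j w y)
    code-injective w y eq with a , b ← combine-injective _ _ _ _ eq = cong₂ _,_ a b

    agree : ∀ {i j} → (∀ w y → code i w y ≡ code j w y) →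
            ∀ {x w} → Walk (adj Γ) x w → g i x ≡ g j x → g i w ≡ g j w
    agree same here eq = eq
    agree {i} {j} same {x} (step {w = w} x~w walk) eq =
      agree same walk (subst (λ w → g i w ≡ g j w) βy≡w
        (begin
          g i (β x (remQuot k y))           ≡⟨ proj₂ (local i x y) ⟨
          β (g i x) (proj₁ (local i x y))   ≡⟨ cong₂ β eq (code-injective x y (same x y)) ⟩
          β (g j x) (proj₁ (local j x y))   ≡⟨ proj₂ (local j x y) ⟩
          g j (β x (remQuot k y))           ∎))
      where
      open ≡-Reasoning
      y = uncurry combine (proj₁ (label x w x~w))
      βy≡w : β x (remQuot k y) ≡ w
      βy≡w = trans (cong (β x) (remQuot-combine _ _)) (proj₂ (label x w x~w))

exp-restrictive : ∀ m k InL → ExpRestrictive (Fin m × Fin k) InL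
-- The summand 2 makes the base exceed 1 whatever `d` is.
exp-restrictive m k InL = 2 + d , 1 , s≤s z≤n , s≤s (s≤s z≤n) , λ N Γ G locally u v _ → begin
  stab2Order G u v * 1 ^ N ≡⟨ cong (stab2Order G u v *_) (^-zeroˡ N) ⟩
  stab2Order G u v * 1     ≡⟨ *-identityʳ _ ⟩
  stab2Order G u v         ≤⟨ stab2Order-≤ Γ G locally u v ⟩
  d ^ N                    ≤⟨ ^-monoˡ-≤ N (m≤n+m d 2) ⟩
  (2 + d) ^ N              ∎
  where
  open ≤-Reasoning
  d = (m * k) ^ (m * k)

-- Estimates for exponential growth

-- Bernoulli's inequality for (1 - 1/(q+1))^M, cleared of denominators.
bernoulli : ∀ q M → suc q ^ M * suc q ≤ q ^ M * suc q + M * suc q ^ M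
bernoulli q zero = ≤-reflexive (sym (+-identityʳ _))
bernoulli q (suc M) = begin
  suc q * p * suc q                              ≡⟨ split q p ⟩
  q * (p * suc q) + suc q * p                    ≤⟨ +-monoˡ-≤ _ (*-monoʳ-≤ q (bernoulli q M)) ⟩
  q * (q ^ M * suc q + M * p) + suc q * p        ≤⟨ m≤m+n _ (M * p) ⟩
  q * (q ^ M * suc q + M * p) + suc q * p + M * p  ≡⟨ gather q p (q ^ M) M ⟩
  q * q ^ M * suc q + suc M * (suc q * p)        ∎
  where
  open ≤-Reasoning
  p = suc q ^ M
  split : ∀ q p → suc q * p * suc q ≡ q * (p * suc q) + suc q * p
  split = solve-∀
  gather : ∀ q p s M → q * (s * suc q + M * p) + suc q * p + M * p ≡ q * s * suc q + suc M * (suc q * p)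
  gather = solve-∀

-- With `suc q ≡ 2 * M`, Bernoulli gives (1 - 1/(q+1))^M ≥ 1 - M/(q+1) = 1/2.
[1+q]^M≤2q^M : ∀ q M → suc q ≡ 2 * M → suc q ^ M ≤ 2 * q ^ M
[1+q]^M≤2q^M q M@(suc _) eq = *-cancelʳ-≤ _ _ M (+-cancelʳ-≤ (M * p) _ _ (begin
  p * M + M * p            ≡⟨ lhs p M ⟩
  p * (2 * M)              ≡⟨ cong (p *_) eq ⟨
  p * suc q                ≤⟨ bernoulli q M ⟩
  q ^ M * suc q + M * p    ≡⟨ cong (λ t → q ^ M * t + M * p) eq ⟩
  q ^ M * (2 * M) + M * p  ≡⟨ cong (_+ M * p) (rhs (q ^ M) M) ⟩
  2 * q ^ M * M + M * p    ∎))
  where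
  open ≤-Reasoning
  p = suc q ^ M
  lhs : ∀ p M → p * M + M * p ≡ p * (2 * M)
  lhs = solve-∀
  rhs : ∀ s M → s * (2 * M) ≡ 2 * s * M
  rhs = solve-∀

*-^-distrib : ∀ a b n → (a * b) ^ n ≡ a ^ n * b ^ n
*-^-distrib a b zero = refl
*-^-distrib a b (suc n) = trans (cong (a * b *_) (*-^-distrib a b n)) (interchange a b (a ^ n) (b ^ n))
  where
  interchange : ∀ a b c d → a * b * (c * d) ≡ a * c * (b * d)
  interchange = solve-∀

square-cancel-≤ : ∀ a b → a * a ≤ b * b → a ≤ b
square-cancel-≤ a b a²≤b² = ≮⇒≥ λ b<a → <⇒≱ (*-mono-< b<a b<a) a²≤b²

n≤2^n : ∀ n → n ≤ 2 ^ n
n≤2^n zero = z≤n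
n≤2^n (suc n) = begin
  1 + n           ≤⟨ +-mono-≤ (m^n>0 2 n) (n≤2^n n) ⟩
  2 ^ n + 2 ^ n   ≡⟨ cong (2 ^ n +_) (+-identityʳ _) ⟨
  2 * 2 ^ n       ∎
  where open ≤-Reasoning

-- 4m ≤ n makes m² at most 2^(n/2), hence s at least 2^(n/2).
exponential-bound : ∀ m n s q → suc q ≡ 2 * (2 * m) → 4 * m ≤ n →
  2 ^ n ≤ s * (m * m) → suc q ^ (m * n) ≤ s * q ^ (m * n)
exponential-bound m n s q eq 4m≤n bound = square-cancel-≤ _ _ (begin
  suc q ^ (m * n) * suc q ^ (m * n)    ≡⟨ double (suc q) ⟩
  -- The hypothesis on `q` is made for this step: the ratio (q+1)/q raised to the power 2m is at
  -- most 2. Both sides were squared so that the exponent 2m appears and no root of `2 ^ n` is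
  -- taken.
  (suc q ^ (2 * m)) ^ n                ≤⟨ ^-monoˡ-≤ n ([1+q]^M≤2q^M q (2 * m) eq) ⟩
  (2 * q ^ (2 * m)) ^ n                ≡⟨ *-^-distrib 2 _ n ⟩
  2 ^ n * (q ^ (2 * m)) ^ n            ≡⟨ cong (2 ^ n *_) (double q) ⟨
  2 ^ n * (Q * Q)                      ≤⟨ *-monoˡ-≤ (Q * Q) 2^n≤s² ⟩
  s * s * (Q * Q)                      ≡⟨ regroup s Q ⟩
  s * Q * (s * Q)                      ∎)
  where
  open ≤-Reasoning
  Q = q ^ (m * n)
  regroup : ∀ s Q → s * s * (Q * Q) ≡ s * Q * (s * Q)
  regroup = solve-∀
  expo : ∀ m n → m * n + m * n ≡ 2 * m * n
  expo = solve-∀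
  double : ∀ t → t ^ (m * n) * t ^ (m * n) ≡ (t ^ (2 * m)) ^ n
  double t = trans (sym (^-distribˡ-+-* t (m * n) (m * n)))
    (trans (cong (t ^_) (expo m n)) (sym (^-*-assoc t (2 * m) n)))
  four : ∀ t → t * t * (t * t) ≡ t * (t * (t * (t * 1)))
  four = solve-∀
  sq : ∀ s t → s * (t * t) * (s * (t * t)) ≡ s * s * (t * t * (t * t))
  sq = solve-∀
  m⁴≤2^n : m * m * (m * m) ≤ 2 ^ n
  m⁴≤2^n = begin
    m * m * (m * m) ≡⟨ four m ⟩
    m ^ 4           ≤⟨ ^-monoˡ-≤ 4 (n≤2^n m) ⟩
    (2 ^ m) ^ 4     ≡⟨ ^-*-assoc 2 m 4 ⟩
    2 ^ (m * 4)     ≤⟨ ^-monoʳ-≤ 2 (subst (_≤ n) (*-comm 4 m) 4m≤n) ⟩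
    2 ^ n           ∎
  2^n≤s² : 2 ^ n ≤ s * s
  2^n≤s² = *-cancelʳ-≤ _ _ (2 ^ n) {{m^n≢0 2 n}} (begin
    2 ^ n * 2 ^ n                    ≤⟨ *-mono-≤ bound bound ⟩
    s * (m * m) * (s * (m * m))      ≡⟨ sq s m ⟩
    s * s * (m * m * (m * m))        ≤⟨ *-monoʳ-≤ (s * s) m⁴≤2^n ⟩
    s * s * 2 ^ n                    ∎)

-- The cyclic group

module Cyclic (r : ℕ) where

  ℤₙ = Fin (suc r)

  infixl 6 _⊕_
  infix 8 ⊖_

  opaque

    ⟦_⟧ : ℕ → ℤₙ
    ⟦ a ⟧ = a mod suc r

    _⊕_ : ℤₙ → ℤₙ → ℤₙ
    x ⊕ y = ⟦ toℕ x + toℕ y ⟧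

    ⊖_ : ℤₙ → ℤₙ
    ⊖ x = ⟦ suc r ∸ toℕ x ⟧

    toℕ-⟦⟧ : ∀ a → toℕ ⟦ a ⟧ ≡ a % suc r
    toℕ-⟦⟧ a = toℕ-fromℕ< (m%n<n a (suc r))

    ⟦⟧-toℕ : ∀ x → ⟦ toℕ x ⟧ ≡ x
    ⟦⟧-toℕ x = toℕ-injective (trans (toℕ-⟦⟧ (toℕ x)) (m<n⇒m%n≡m (toℕ<n x)))

    ⟦⟧-cong-% : ∀ {a b} → a % suc r ≡ b % suc r → ⟦ a ⟧ ≡ ⟦ b ⟧
    ⟦⟧-cong-% {a} {b} eq = toℕ-injective (trans (toℕ-⟦⟧ a) (trans eq (sym (toℕ-⟦⟧ b))))

    ⟦⟧-⊕ : ∀ a b → ⟦ a ⟧ ⊕ ⟦ b ⟧ ≡ ⟦ a + b ⟧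
    ⟦⟧-⊕ a b = ⟦⟧-cong-% {toℕ ⟦ a ⟧ + toℕ ⟦ b ⟧} {a + b} (begin
      (toℕ ⟦ a ⟧ + toℕ ⟦ b ⟧) % suc r      ≡⟨ cong₂ (λ s t → (s + t) % suc r) (toℕ-⟦⟧ a) (toℕ-⟦⟧ b) ⟩
      (a % suc r + b % suc r) % suc r      ≡⟨ %-distribˡ-+ a b (suc r) ⟨
      (a + b) % suc r                      ∎)
      where open ≡-Reasoning

    ⊕-comm : ∀ x y → x ⊕ y ≡ y ⊕ x
    ⊕-comm x y = cong ⟦_⟧ (+-comm (toℕ x) (toℕ y))

    ⊕-assoc : ∀ x y z → x ⊕ y ⊕ z ≡ x ⊕ (y ⊕ z)
    ⊕-assoc x y z = begin
      x ⊕ y ⊕ z                      ≡⟨ cong (x ⊕ y ⊕_) (⟦⟧-toℕ z) ⟨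
      ⟦ toℕ x + toℕ y ⟧ ⊕ ⟦ toℕ z ⟧  ≡⟨ ⟦⟧-⊕ (toℕ x + toℕ y) (toℕ z) ⟩
      ⟦ toℕ x + toℕ y + toℕ z ⟧      ≡⟨ cong ⟦_⟧ (+-assoc (toℕ x) (toℕ y) (toℕ z)) ⟩
      ⟦ toℕ x + (toℕ y + toℕ z) ⟧    ≡⟨ ⟦⟧-⊕ (toℕ x) (toℕ y + toℕ z) ⟨
      ⟦ toℕ x ⟧ ⊕ (y ⊕ z)            ≡⟨ cong (_⊕ (y ⊕ z)) (⟦⟧-toℕ x) ⟩
      x ⊕ (y ⊕ z)                    ∎
      where open ≡-Reasoning

    ⊕-identityˡ : ∀ x → ⟦ 0 ⟧ ⊕ x ≡ x
    ⊕-identityˡ x = trans (cong (⟦ 0 ⟧ ⊕_) (sym (⟦⟧-toℕ x))) (trans (⟦⟧-⊕ 0 (toℕ x)) (⟦⟧-toℕ x))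

    ⊕-inverseˡ : ∀ x → ⊖ x ⊕ x ≡ ⟦ 0 ⟧
    ⊕-inverseˡ x = begin
      ⊖ x ⊕ x                        ≡⟨ cong (⊖ x ⊕_) (⟦⟧-toℕ x) ⟨
      ⊖ x ⊕ ⟦ toℕ x ⟧                ≡⟨ ⟦⟧-⊕ (suc r ∸ toℕ x) (toℕ x) ⟩
      ⟦ suc r ∸ toℕ x + toℕ x ⟧      ≡⟨ cong ⟦_⟧ (ℕₚ.m∸n+n≡m (ℕₚ.<⇒≤ (toℕ<n x))) ⟩
      ⟦ suc r ⟧                      ≡⟨ ⟦⟧-cong-% {suc r} {0} (n%n≡0 (suc r)) ⟩
      ⟦ 0 ⟧                          ∎
      where open ≡-Reasoning

  abelianGroup : AbelianGroup _ _
  abelianGroup = record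
    { Carrier = ℤₙ ; _≈_ = _≡_ ; _∙_ = _⊕_ ; ε = ⟦ 0 ⟧ ; _⁻¹ = ⊖_
    ; isAbelianGroup = record
      { isGroup = record
        { isMonoid = record
          { isSemigroup = record
            { isMagma = record { isEquivalence = isEquivalence ; ∙-cong = cong₂ _⊕_ }
            ; assoc = ⊕-assoc }
          ; identity = ⊕-identityˡ , λ x → trans (⊕-comm x _) (⊕-identityˡ x) }
        ; inverse = ⊕-inverseˡ , λ x → trans (⊕-comm x _) (⊕-inverseˡ x)
        ; ⁻¹-cong = cong ⊖_ }
      ; comm = ⊕-comm } }

  open AbelianGroupₚ abelianGroup public using (⁻¹-∙-comm; ⁻¹-involutive; ∙-cancelˡ)

  ⊕-cancel : ∀ x y → y ⊕ ⊖ x ⊕ x ≡ y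
  ⊕-cancel x y = trans (⊕-assoc y (⊖ x) x)
    (trans (cong (y ⊕_) (⊕-inverseˡ x)) (trans (⊕-comm y _) (⊕-identityˡ y)))

  successor-induction : (P : ℤₙ → Set) → P ⟦ 0 ⟧ → (∀ x → P x → P (x ⊕ ⟦ 1 ⟧)) → ∀ x → P x
  successor-induction P base next x = subst P (⟦⟧-toℕ x) (go (toℕ x))
    where
    go : ∀ a → P ⟦ a ⟧
    go zero = base
    go (suc a) = subst P (trans (⟦⟧-⊕ a 1) (cong ⟦_⟧ (+-comm a 1))) (next _ (go a))

  opaque

    -- x ↦ -x and x ↦ -x - 1: two involutions whose product is the translation by 1.
    reflect : Bool → ℤₙ → ℤₙ
    reflect e x = ⊖ (x ⊕ ⟦ if e then 1 else 0 ⟧)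

    reflect-involutive : ∀ e x → reflect e (reflect e x) ≡ x
    reflect-involutive e x = begin
      ⊖ (⊖ (x ⊕ u) ⊕ u)       ≡⟨ ⁻¹-∙-comm (⊖ (x ⊕ u)) u ⟨
      ⊖ ⊖ (x ⊕ u) ⊕ ⊖ u       ≡⟨ cong (_⊕ ⊖ u) (⁻¹-involutive (x ⊕ u)) ⟩
      x ⊕ u ⊕ ⊖ u             ≡⟨ ⊕-assoc x u (⊖ u) ⟩
      x ⊕ (u ⊕ ⊖ u)           ≡⟨ cong (x ⊕_) (trans (⊕-comm u _) (⊕-inverseˡ u)) ⟩
      x ⊕ ⟦ 0 ⟧               ≡⟨ trans (⊕-comm x _) (⊕-identityˡ x) ⟩
      x                       ∎
      where
      open ≡-Reasoning
      u : ℤₙ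
      u = ⟦ if e then 1 else 0 ⟧

    reflect-⊕ : ∀ e c x → reflect e (c ⊕ x) ≡ ⊖ c ⊕ reflect e x
    reflect-⊕ e c x = trans (cong ⊖_ (⊕-assoc c x ⟦ if e then 1 else 0 ⟧)) (sym (⁻¹-∙-comm c (x ⊕ ⟦ if e then 1 else 0 ⟧)))

    reflect-reflect : ∀ x → reflect false (reflect true x) ≡ x ⊕ ⟦ 1 ⟧
    reflect-reflect x = trans (cong ⊖_ (trans (⊕-comm (⊖ (x ⊕ ⟦ 1 ⟧)) ⟦ 0 ⟧) (⊕-identityˡ (⊖ (x ⊕ ⟦ 1 ⟧)))))
      (⁻¹-involutive (x ⊕ ⟦ 1 ⟧))

-- Deciding reachability, by Floyd and Warshall

module _ {A : Set} {E : A → A → Set} where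

  -- The list restricts the intermediate vertices, and its head is visited at most once.
  -- Decidability then follows by recursion on the list.
  Via : List A → A → A → Set
  Via []       x y = x ≡ y ⊎ E x y
  Via (z ∷ zs) x y = Via zs x y ⊎ (Via zs x z × Via zs z y)

  via-star : ∀ zs {x y} → Via zs x y → Star E x y
  via-star []       (inj₁ refl)    = ε
  via-star []       (inj₂ e)       = return e
  via-star (z ∷ zs) (inj₁ p)       = via-star zs p
  via-star (z ∷ zs) (inj₂ (p , q)) = via-star zs p ◅◅ via-star zs q

  via-[] : ∀ zs {x y} → Via [] x y → Via zs x y
  via-[] []       p = p
  via-[] (z ∷ zs) p = inj₁ (via-[] zs p)

  -- When both paths pass through the head of the list, the loop between the two visits is cut out.
  via-trans : ∀ {zs x z y} → z ∈ zs → Via zs x z → Via zs z y → Via zs x y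
  via-trans (here refl) (inj₁ p)       (inj₁ q)       = inj₂ (p , q)
  via-trans (here refl) (inj₁ p)       (inj₂ (_ , q)) = inj₂ (p , q)
  via-trans (here refl) (inj₂ (p , _)) (inj₁ q)       = inj₂ (p , q)
  via-trans (here refl) (inj₂ (p , _)) (inj₂ (_ , q)) = inj₂ (p , q)
  via-trans (there z∈) (inj₁ p)        (inj₁ q)        = inj₁ (via-trans z∈ p q)
  via-trans (there z∈) (inj₁ p)        (inj₂ (q , q′)) = inj₂ (via-trans z∈ p q , q′)
  via-trans (there z∈) (inj₂ (p , p′)) (inj₁ q)        = inj₂ (p , via-trans z∈ p′ q)
  via-trans (there z∈) (inj₂ (p , _))  (inj₂ (_ , q′)) = inj₂ (p , q′)

  star-via : ∀ {zs} → (∀ x → x ∈ zs) → ∀ {x y} → Star E x y → Via zs x y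
  star-via all ε       = via-[] _ (inj₁ refl)
  star-via all (e ◅ s) = via-trans (all _) (via-[] _ (inj₂ e)) (star-via all s)

  module _ (_≟_ : DecidableEquality A) (E? : ∀ x y → Dec (E x y)) where

    via? : ∀ zs x y → Dec (Via zs x y)
    via? []       x y = (x ≟ y) ⊎-dec E? x y
    via? (z ∷ zs) x y = via? zs x y ⊎-dec (via? zs x z ×-dec via? zs z y)

    star? : Enumeration A → ∀ x y → Dec (Star E x y)
    star? all x y = map′ (via-star (elements all)) (star-via (complete all)) (via? (elements all) x y)

-- Labelled graphs and their connected components

module _ {k : ℕ} (T : PermGroup k) where

  -- The condition under which a map of the base graph, combined with any choice of elements of R on
  -- the fibres, acts locally in R≀T. The permutation `b` may change from vertex to vertex.
  record LocallyIn {V : Set} (nbr : V → Fin k → V) (h : V → V) : Set where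
    field
      injective : ∀ u v → h u ≡ h v → u ≡ v
      local     : ∀ u → ∃ λ b → b ∈ elems T × (∀ j → h (nbr u j) ≡ nbr (h u) (app b j))

  -- A k-valent graph on V whose neighbours of u are listed as nbr u j.  Every vertex carries an
  -- index, which is also the label of the edge pointing to it.  The vertex stabilisers act as
  -- T × T_ω, where the second factor acts on the labels around the neighbours.
  record LabelledGraph (V : Set) : Set where
    field
      nbr       : V → Fin k → V
      index     : V → Fin k
      index-nbr : ∀ u j → index (nbr u j) ≡ j
      nbr-back  : ∀ u j → nbr (nbr u j) (index u) ≡ u
      loopless  : ∀ u j → nbr u j ≢ u
      -- The condition on `a` is forced: the edge from a neighbour back to `u` has label `index u`,
      -- and its image must lead back to `v`. For `u ≡ v` this leaves `b` free in T and confines `a`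
      -- to a point stabiliser.
      automorphism : ∀ u v {a b} → a ∈ elems T → b ∈ elems T → app a (index u) ≡ index v →
        ∃ λ h → LocallyIn nbr h × h u ≡ v × (∀ j → h (nbr u j) ≡ nbr v (app b j)) ×
          (∀ j i → h (nbr (nbr u j) i) ≡ nbr (nbr v (app b j)) (app a i))

    Edge : V → V → Set
    Edge u v = ∃ λ j → nbr u j ≡ v

    edge-sym : ∀ {u v} → Edge u v → Edge v u
    edge-sym (j , refl) = _ , nbr-back _ j

  module Component {V : Set} (Λ : LabelledGraph V) (enum : Enumeration V) (_≟_ : DecidableEquality V)
                   (x₀ : V) where
    open LabelledGraph Λ
    open LocallyIn

    edge? : ∀ u v → Dec (Edge u v)
    edge? u v = any? λ j → nbr u j ≟ v

    component : List V
    component = filter (star? _≟_ edge? enum x₀) (elements enum)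

    n : ℕ
    n = length component

    ι : Fin n → V
    ι = List.lookup component

    ι-injective : ∀ {i j} → ι i ≡ ι j → i ≡ j
    ι-injective = lookup-injective (Uniqueₚ.filter⁺ (star? _≟_ edge? enum x₀) (distinct enum))

    reached : ∀ i → Star Edge x₀ (ι i)
    reached i = proj₂ (∈-filter⁻ (star? _≟_ edge? enum x₀) {xs = elements enum} (∈-lookup i))

    at∈ : ∀ {v} → Star Edge x₀ v → v ∈ component
    at∈ s = ∈-filter⁺ (star? _≟_ edge? enum x₀) (complete enum _) s

    at : ∀ {v} → Star Edge x₀ v → Fin n
    at s = Any.index (at∈ s)

    ι-at : ∀ {v} (s : Star Edge x₀ v) → ι (at s) ≡ v
    ι-at s = lookup-index-∈ (at∈ s)

    edge : ∀ u j → Star Edge u (nbr u j)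
    edge u j = return (j , refl)

    nbrᶜ : Fin n → Fin k → Fin n
    nbrᶜ u j = at (reached u ◅◅ edge (ι u) j)

    ι-nbr : ∀ u j → ι (nbrᶜ u j) ≡ nbr (ι u) j
    ι-nbr u j = ι-at _

    -- One vertex of the component that is mapped into the component suffices: `h` sends edges to
    -- edges, so a path from `u` becomes a path from `v`.
    restrict : ∀ u v {h} → LocallyIn nbr h → h (ι u) ≡ ι v →
               ∃ λ hᶜ → LocallyIn nbrᶜ hᶜ × (∀ w → ι (hᶜ w) ≡ h (ι w))
    restrict u v {h} legal hu≡v = hᶜ , record { injective = hᶜ-injective ; local = hᶜ-local } , ι-hᶜ
      where
      h-edge : ∀ {x y} → Edge x y → Edge (h x) (h y)
      h-edge {x} (j , refl) with b , _ , eq ← local legal x = _ , sym (eq j)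

      path : ∀ w → Star Edge x₀ (h (ι w))
      path w = reached v ◅◅ subst (λ y → Star Edge y (h (ι w))) hu≡v
        (gmap h h-edge (reverse edge-sym (reached u) ◅◅ reached w))

      hᶜ : Fin n → Fin n
      hᶜ w = at (path w)

      ι-hᶜ : ∀ w → ι (hᶜ w) ≡ h (ι w)
      ι-hᶜ w = ι-at (path w)

      hᶜ-injective : ∀ w w′ → hᶜ w ≡ hᶜ w′ → w ≡ w′
      hᶜ-injective w w′ eq = ι-injective (injective legal _ _
        (trans (sym (ι-hᶜ w)) (trans (cong ι eq) (ι-hᶜ w′))))

      hᶜ-local : ∀ w → ∃ λ b → b ∈ elems T × (∀ j → hᶜ (nbrᶜ w j) ≡ nbrᶜ (hᶜ w) (app b j))
      hᶜ-local w with b , b∈ , eq ← local legal (ι w) = b , b∈ , λ j → ι-injective (begin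
        ι (hᶜ (nbrᶜ w j))            ≡⟨ ι-hᶜ _ ⟩
        h (ι (nbrᶜ w j))             ≡⟨ cong h (ι-nbr w j) ⟩
        h (nbr (ι w) j)              ≡⟨ eq j ⟩
        nbr (h (ι w)) (app b j)      ≡⟨ cong (λ x → nbr x (app b j)) (ι-hᶜ w) ⟨
        nbr (ι (hᶜ w)) (app b j)     ≡⟨ ι-nbr _ _ ⟨
        ι (nbrᶜ (hᶜ w) (app b j))    ∎)
        where open ≡-Reasoning

    automorphismᶜ : ∀ u v {a b} → a ∈ elems T → b ∈ elems T → app a (index (ι u)) ≡ index (ι v) →
      ∃ λ h → LocallyIn nbrᶜ h × h u ≡ v × (∀ j → h (nbrᶜ u j) ≡ nbrᶜ v (app b j)) ×
        (∀ j i → h (nbrᶜ (nbrᶜ u j) i) ≡ nbrᶜ (nbrᶜ v (app b j)) (app a i))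
    automorphismᶜ u v {a} {b} a∈ b∈ au≡v
      with h , legal , hu≡v , near , far ← automorphism (ι u) (ι v) a∈ b∈ au≡v
      with hᶜ , legalᶜ , ι-hᶜ ← restrict u v legal hu≡v
      = hᶜ , legalᶜ , ι-injective (trans (ι-hᶜ u) hu≡v)
      , (λ j → ι-injective (begin
          ι (hᶜ (nbrᶜ u j))       ≡⟨ ι-hᶜ _ ⟩
          h (ι (nbrᶜ u j))        ≡⟨ cong h (ι-nbr u j) ⟩
          h (nbr (ι u) j)         ≡⟨ near j ⟩
          nbr (ι v) (app b j)     ≡⟨ ι-nbr v _ ⟨
          ι (nbrᶜ v (app b j))    ∎))
      , (λ j i → ι-injective (begin
          ι (hᶜ (nbrᶜ (nbrᶜ u j) i))                  ≡⟨ ι-hᶜ _ ⟩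
          h (ι (nbrᶜ (nbrᶜ u j) i))                   ≡⟨ cong h (ι-nbr₂ u j i) ⟩
          h (nbr (nbr (ι u) j) i)                     ≡⟨ far j i ⟩
          nbr (nbr (ι v) (app b j)) (app a i)         ≡⟨ ι-nbr₂ v _ _ ⟨
          ι (nbrᶜ (nbrᶜ v (app b j)) (app a i))       ∎))
      where
      open ≡-Reasoning
      ι-nbr₂ : ∀ u j i → ι (nbrᶜ (nbrᶜ u j) i) ≡ nbr (nbr (ι u) j) i
      ι-nbr₂ u j i = trans (ι-nbr _ i) (cong (λ x → nbr x i) (ι-nbr u j))

    labelledComponent : LabelledGraph (Fin n)
    labelledComponent = record
      { nbr          = nbrᶜ
      ; index        = index ∘ ι
      ; index-nbr    = λ u j → trans (cong index (ι-nbr u j)) (index-nbr (ι u) j)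
      ; nbr-back     = λ u j → ι-injective (trans (ι-nbr _ _)
                         (trans (cong (λ x → nbr x (index (ι u))) (ι-nbr u j)) (nbr-back (ι u) j)))
      ; loopless     = λ u j eq → loopless (ι u) j (trans (sym (ι-nbr u j)) (cong ι eq))
      ; automorphism = automorphismᶜ
      }

    connectedᶜ : ∀ u v → Star (LabelledGraph.Edge labelledComponent) u v
    connectedᶜ u v = lift u (reverse edge-sym (reached u) ◅◅ reached v) refl refl
      where
      lift : ∀ w {x y} → Star Edge x y → x ≡ ι w → y ≡ ι v →
             Star (LabelledGraph.Edge labelledComponent) w v
      lift w ε x≡w y≡v = subst (Star _ w) (ι-injective (trans (sym x≡w) y≡v)) ε
      lift w ((j , refl) ◅ s) x≡w y≡v = (j , refl) ◅
        lift (nbrᶜ w j) s (trans (cong (λ x → nbr x j) x≡w) (sym (ι-nbr w j))) y≡v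

    size-≥ : ∀ {N} (value : V → Fin N) → (∀ y → ∃ λ v → Star Edge x₀ v × value v ≡ y) → N ≤ n
    size-≥ value hit = injective⇒≤ {f = λ y → at (proj₁ (proj₂ (hit y)))} λ {y} {z} eq → begin
        y                                      ≡⟨ proj₂ (proj₂ (hit y)) ⟨
        value (proj₁ (hit y))                  ≡⟨ cong value (ι-at (proj₁ (proj₂ (hit y)))) ⟨
        value (ι (at (proj₁ (proj₂ (hit y))))) ≡⟨ cong (value ∘ ι) eq ⟩
        value (ι (at (proj₁ (proj₂ (hit z))))) ≡⟨ cong value (ι-at (proj₁ (proj₂ (hit z)))) ⟩
        value (proj₁ (hit z))                  ≡⟨ proj₂ (proj₂ (hit z)) ⟩
        z                                      ∎
      where open ≡-Reasoning

-- Covers of the complete bipartite graph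

module _ {A : Set} where

  select : Bool → A → A → Bool → A
  select true  x y true  = x
  select true  x y false = y
  select false x y true  = y
  select false x y false = x

  select-same : ∀ s x y → select s x y s ≡ x
  select-same true  x y = refl
  select-same false x y = refl

  select-other : ∀ s x y → select s x y (not s) ≡ y
  select-other true  x y = refl
  select-other false x y = refl

xor-cancel : ∀ s s′ → s xor (s xor s′) ≡ s′
xor-cancel true  s′ = not-involutive s′
xor-cancel false s′ = refl

not-xor : ∀ s e → not s xor e ≡ not (s xor e)
not-xor true  e = sym (not-involutive e)
not-xor false e = refl

xor-injective : ∀ s s′ e → s xor e ≡ s′ xor e → s ≡ s′
xor-injective true  true  _     _ = refl
xor-injective true  false true  ()
xor-injective true  false false ()
xor-injective false true  true  ()
xor-injective false true  false ()
xor-injective false false _     _ = refl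

-- The cover of K_{k,k} with voltage e_pq ∈ ℤₙ^{k×k} on the edge pq.  The matrix of a cell is
-- indexed by its own side first, and is negated when the side changes, so that exchanging the two
-- sides is an automorphism.
module Cover (k r : ℕ) where

  open Cyclic r public

  Matrix : Set
  Matrix = Vec (Vec ℤₙ k) k

  opaque

    entry : Matrix → Fin k → Fin k → ℤₙ
    entry f p q = lookup (lookup f p) q

    matrix : (Fin k → Fin k → ℤₙ) → Matrix
    matrix g = tabulate λ p → tabulate (g p)

    entry-matrix : ∀ g p q → entry (matrix g) p q ≡ g p q
    entry-matrix g p q = trans (cong (λ v → lookup v q) (lookup∘tabulate _ p)) (lookup∘tabulate (g p) q)

    matrix-ext : ∀ {f f′} → (∀ p q → entry f p q ≡ entry f′ p q) → f ≡ f′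
    matrix-ext eq = lookup-ext λ p → lookup-ext (eq p)

  Cell : Set
  Cell = Bool × Fin k × Matrix

  index : Cell → Fin k
  index (_ , i , _) = i

  flips : Fin k → Fin k → Fin k → Fin k → Bool
  flips i j p q = does (p Finₚ.≟ i) ∧ does (q Finₚ.≟ j)

  -- Crossing any edge transposes and negates. At the entry of the crossed edge itself
  -- `reflect true` also contributes the voltage, and since it is an involution the way back undoes
  -- it.
  nbr : Cell → Fin k → Cell
  nbr (s , i , f) j = not s , j , matrix λ q p → reflect (flips i j p q) (entry f p q)

  cell-≡ : ∀ {s s′ i i′ f f′} → s ≡ s′ → i ≡ i′ → (∀ p q → entry f p q ≡ entry f′ p q) →
           _≡_ {A = Cell} (s , i , f) (s′ , i′ , f′)
  cell-≡ refl refl eq = cong (λ f → _ , _ , f) (matrix-ext eq)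

  nbr-back : ∀ u j → nbr (nbr u j) (index u) ≡ u
  nbr-back (s , i , f) j = cell-≡ (not-involutive s) refl λ p q → begin
    entry (matrix _) p q
      ≡⟨ entry-matrix _ p q ⟩
    reflect (flips j i q p) (entry (matrix _) q p)
      ≡⟨ cong₂ reflect (∧-comm (does (q Finₚ.≟ j)) _) (entry-matrix _ q p) ⟩
    reflect (flips i j p q) (reflect (flips i j p q) (entry f p q))
      ≡⟨ reflect-involutive (flips i j p q) _ ⟩
    entry f p q ∎
    where open ≡-Reasoning

  loopless : ∀ u j → nbr u j ≢ u
  loopless (true  , _) j ()
  loopless (false , _) j ()

  module _ (T : PermGroup k) where

    inverse : ∀ {b} → b ∈ elems T → Fin k → Fin k
    inverse b∈ i = proj₁ (fin-injective⇒surjective (∈-isPerm T b∈) i)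

    app-inverse : ∀ {b} (b∈ : b ∈ elems T) i → app b (inverse b∈ i) ≡ i
    app-inverse b∈ i = proj₂ (fin-injective⇒surjective (∈-isPerm T b∈) i)

    inverse-app : ∀ {b} (b∈ : b ∈ elems T) i → inverse b∈ (app b i) ≡ i
    inverse-app b∈ i = ∈-isPerm T b∈ _ _ (app-inverse b∈ _)

    -- S acts on the two sides of the cover, e tells whether the sides are exchanged, and c is
    -- the translation of the matrices (up to the sign and transposition attached to the side).
    module Automorphism (e : Bool) (S : Bool → ∃ λ b → b ∈ elems T) (c : Bool → Fin k → Fin k → ℤₙ)
                        (c-odd : ∀ s p q → c (not s) q p ≡ ⊖ c s p q) where

      act : Bool → Fin k → Fin k
      act s = app (proj₁ (S s))

      act⁻¹ : Bool → Fin k → Fin k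
      act⁻¹ s = inverse (proj₂ (S s))

      -- Because matrices are stored relative to their own side, exchanging the sides alters the
      -- side bit alone, and one formula covers both values of `e`.
      move : Cell → Cell
      move (s , i , f) =
        s xor e , act s i , matrix λ p q → c s p q ⊕ entry f (act⁻¹ s p) (act⁻¹ (not s) q)

      flips-act : ∀ s i j p q → flips i j (act⁻¹ s p) (act⁻¹ (not s) q) ≡ flips (act s i) (act (not s) j) p q
      flips-act s i j p q = cong₂ _∧_ (does-act s i p) (does-act (not s) j q)
        where
        does-act : ∀ s i p → does (act⁻¹ s p Finₚ.≟ i) ≡ does (p Finₚ.≟ act s i)
        does-act s i p = does-⇔ (mk⇔
          (λ eq → trans (sym (app-inverse (proj₂ (S s)) p)) (cong (act s) eq))
          (λ eq → trans (cong (act⁻¹ s) eq) (inverse-app (proj₂ (S s)) i))) (act⁻¹ s p Finₚ.≟ i) (p Finₚ.≟ act s i)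

      -- A translation passes through a reflection with its sign changed, and `c-odd` says that the
      -- translation on the opposite side has exactly this sign. The marked entry of the crossed
      -- edge moves along with its two ends by `flips-act`.
      move-nbr : ∀ u j → move (nbr u j) ≡ nbr (move u) (act (not (proj₁ u)) j)
      move-nbr u@(s , i , f) j = cell-≡ (not-xor s e) refl λ q p → begin
        entry (matrix _) q p
          ≡⟨ entry-matrix _ q p ⟩
        c (not s) q p ⊕ entry (matrix _) (act⁻¹ (not s) q) (act⁻¹ (not (not s)) p)
          ≡⟨ cong (c (not s) q p ⊕_) (entry-matrix _ _ _) ⟩
        c (not s) q p ⊕ reflect (flips i j (act⁻¹ (not (not s)) p) (act⁻¹ (not s) q))
                                (entry f (act⁻¹ (not (not s)) p) (act⁻¹ (not s) q))
          ≡⟨ cong (λ t → c (not s) q p ⊕ reflect (flips i j (act⁻¹ t p) (act⁻¹ (not s) q))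
                                                 (entry f (act⁻¹ t p) (act⁻¹ (not s) q)))
                  (not-involutive s) ⟩
        c (not s) q p ⊕ reflect (flips i j (act⁻¹ s p) (act⁻¹ (not s) q))
                                (entry f (act⁻¹ s p) (act⁻¹ (not s) q))
          ≡⟨ cong₂ (λ x b → x ⊕ reflect b (entry f (act⁻¹ s p) (act⁻¹ (not s) q)))
                   (c-odd s p q) (flips-act s i j p q) ⟩
        ⊖ c s p q ⊕ reflect (flips (act s i) (act (not s) j) p q) (entry f (act⁻¹ s p) (act⁻¹ (not s) q))
          ≡⟨ reflect-⊕ (flips (act s i) (act (not s) j) p q) (c s p q) (entry f (act⁻¹ s p) (act⁻¹ (not s) q)) ⟨
        reflect (flips (act s i) (act (not s) j) p q) (c s p q ⊕ entry f (act⁻¹ s p) (act⁻¹ (not s) q))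
          ≡⟨ cong (reflect (flips (act s i) (act (not s) j) p q)) (entry-matrix _ p q) ⟨
        reflect (flips (act s i) (act (not s) j) p q) (entry (matrix _) p q)
          ≡⟨ entry-matrix _ q p ⟨
        entry (matrix _) q p ∎
        where open ≡-Reasoning

      move-injective : ∀ u v → move u ≡ move v → u ≡ v
      move-injective (s , i , f) (s′ , i′ , f′) eq
        with s≡s′ , rest ← ,-injective eq
        with refl ← xor-injective s s′ e s≡s′
        with ai≡ai′ , f≡f′ ← ,-injective rest
        = cell-≡ refl (∈-isPerm T (proj₂ (S s)) _ _ ai≡ai′) λ p q → begin
            entry f p q
              ≡⟨ cong₂ (entry f) (inverse-app (proj₂ (S s)) p) (inverse-app (proj₂ (S (not s))) q) ⟨
            entry f (act⁻¹ s (act s p)) (act⁻¹ (not s) (act (not s) q))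
              ≡⟨ ∙-cancelˡ _ _ _ (trans (sym (entry-matrix _ (act s p) (act (not s) q)))
                   (trans (cong (λ m → entry m (act s p) (act (not s) q)) f≡f′)
                     (entry-matrix _ (act s p) (act (not s) q)))) ⟩
            entry f′ (act⁻¹ s (act s p)) (act⁻¹ (not s) (act (not s) q))
              ≡⟨ cong₂ (entry f′) (inverse-app (proj₂ (S s)) p) (inverse-app (proj₂ (S (not s))) q) ⟩
            entry f′ p q ∎
        where open ≡-Reasoning

      move-locally : LocallyIn T nbr move
      move-locally = record
        { injective = move-injective
        ; local     = λ u → _ , proj₂ (S (not (proj₁ u))) , move-nbr u
        }

    automorphism : ∀ u v {a b} → a ∈ elems T → b ∈ elems T → app a (index u) ≡ index v →
      ∃ λ h → LocallyIn T nbr h × h u ≡ v × (∀ j → h (nbr u j) ≡ nbr v (app b j)) ×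
        (∀ j i → h (nbr (nbr u j) i) ≡ nbr (nbr v (app b j)) (app a i))
    automorphism u@(s , i , f) v@(s′ , i′ , f′) {a} {b} a∈ b∈ ai≡i′ =
      move , move-locally , move-u , near , λ j i → trans (move-nbr (nbr u j) i)
        (cong₂ nbr (near j) (cong (λ x → app (proj₁ x) i)
          (trans (cong S (not-involutive s)) (select-same s _ _))))
      where
      S : Bool → ∃ λ b → b ∈ elems T
      -- The graph is bipartite: `u` and the neighbours of its neighbours lie on side `s`, the
      -- neighbours of `u` on the other. So `b` permutes the labels around `u` and `a` those around
      -- each neighbour.
      S = select s (a , a∈) (b , b∈)

      shift : Fin k → Fin k → ℤₙ
      -- The solution of `move u ≡ v` for the translation; `c` extends it to the other side in the
      -- only way that is odd.
      shift p q = entry f′ p q ⊕ ⊖ entry f (inverse (proj₂ (S s)) p) (inverse (proj₂ (S (not s))) q)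

      c : Bool → Fin k → Fin k → ℤₙ
      c = select s shift λ q p → ⊖ shift p q

      select-odd : ∀ s t (g : Fin k → Fin k → ℤₙ) p q →
        select s g (λ q p → ⊖ g p q) (not t) q p ≡ ⊖ select s g (λ q p → ⊖ g p q) t p q
      select-odd true  true  g p q = refl
      select-odd true  false g p q = sym (⁻¹-involutive _)
      select-odd false true  g p q = sym (⁻¹-involutive _)
      select-odd false false g p q = refl

      open Automorphism (s xor s′) S c (λ t → select-odd s t shift)

      move-u : move u ≡ v
      move-u = cell-≡ (xor-cancel s s′)
        (trans (cong (λ x → app (proj₁ x) i) (select-same s _ _)) ai≡i′)
        λ p q → trans (entry-matrix _ p q)
          (trans (cong (λ g → g p q ⊕ entry f (act⁻¹ s p) (act⁻¹ (not s) q)) (select-same s shift _))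
            (⊕-cancel _ _))

      near : ∀ j → move (nbr u j) ≡ nbr v (app b j)
      near j = trans (move-nbr u j) (cong₂ nbr move-u
        (cong (λ x → app (proj₁ x) j) (select-other s _ _)))

    cover : LabelledGraph T Cell
    cover = record
      { nbr = nbr ; index = index ; index-nbr = λ _ _ → refl ; nbr-back = nbr-back
      ; loopless = loopless ; automorphism = automorphism }

    -- Walking once around a 4-cycle through the edge ij adds 1 to the entry ij.
    module _ {i i′ j j′ : Fin k} (i≢i′ : i ≢ i′) (j≢j′ : j ≢ j′) where
      open LabelledGraph cover using (Edge)

      base : Cell
      base = true , i , matrix (λ _ _ → ⟦ 0 ⟧)

      value : Cell → ℤₙ
      value (_ , _ , f) = entry f i j

      round : Cell → Cell
      round u = nbr (nbr (nbr (nbr u j) i′) j′) i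

      value-round : ∀ f → value (round (true , i , f)) ≡ value (true , i , f) ⊕ ⟦ 1 ⟧
      value-round f = begin
        -- The four edges appear with the last one outermost. Only the first edge carries its
        -- voltage in the entry `i`, `j`; each of the others differs from it in an end and
        -- contributes a plain negation.
        value (round (true , i , f))
          ≡⟨ entry-matrix _ i j ⟩
        reflect (flips j′ i j i) _
          ≡⟨ cong₂ reflect (cong (_∧ does (i Finₚ.≟ i)) (dec-false (j Finₚ.≟ j′) j≢j′)) (entry-matrix _ j i) ⟩
        reflect false (reflect (flips i′ j′ i j) _)
          ≡⟨ cong (reflect false) (cong₂ reflect
               (cong (_∧ does (j Finₚ.≟ j′)) (dec-false (i Finₚ.≟ i′) i≢i′)) (entry-matrix _ i j)) ⟩
        reflect false (reflect false (reflect (flips j i′ j i) _))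
          ≡⟨ reflect-involutive false _ ⟩
        reflect (flips j i′ j i) _
          ≡⟨ cong₂ reflect (trans (cong (does (j Finₚ.≟ j) ∧_) (dec-false (i Finₚ.≟ i′) i≢i′))
               (∧-zeroʳ _)) (entry-matrix _ j i) ⟩
        reflect false (reflect (flips i j i j) (entry f i j))
          ≡⟨ cong (λ b → reflect false (reflect b (entry f i j)))
               (cong₂ _∧_ (dec-true (i Finₚ.≟ i) refl) (dec-true (j Finₚ.≟ j) refl)) ⟩
        reflect false (reflect true (entry f i j))
          ≡⟨ reflect-reflect (entry f i j) ⟩
        entry f i j ⊕ ⟦ 1 ⟧ ∎
        where open ≡-Reasoning

      reachable-value : ∀ y → ∃ λ f → Star Edge base (true , i , f) × entry f i j ≡ y
      reachable-value = successor-induction _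
        (_ , ε , entry-matrix _ i j)
        λ y (f , s , eq) → _ ,
          s ◅◅ (j , refl) ◅ (i′ , refl) ◅ (j′ , refl) ◅ (i , refl) ◅ ε ,
          trans (value-round f) (cong (_⊕ ⟦ 1 ⟧) eq)

enumCell : ∀ k r → Enumeration (Cover.Cell k r)
enumCell k r = enum× enumBool (enum× (enumFin k) (enumVec (enumVec (enumFin (suc r)) k) k))

_≟-Cell_ : ∀ {k r} → DecidableEquality (Cover.Cell k r)
_≟-Cell_ = ≡-dec Boolₚ._≟_ (≡-dec Finₚ._≟_ (Vecₚ.≡-dec (Vecₚ.≡-dec Finₚ._≟_)))

distinct-from : ∀ {k} → 1 < k → (i : Fin k) → ∃ λ j → i ≢ j
distinct-from (s≤s (s≤s _)) zero    = suc zero , λ ()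
distinct-from (s≤s (s≤s _)) (suc i) = zero , λ ()

opaque

  large-labelled-graph : ∀ {k} (T : PermGroup k) → 1 < k → ∀ (ω : Fin k) n₀ →
    ∃ λ n → n₀ ≤ n × Σ (LabelledGraph T (Fin n)) λ Λ →
      (∀ u v → Star (LabelledGraph.Edge Λ) u v) × ∃ λ x₀ → LabelledGraph.index Λ x₀ ≡ ω
  large-labelled-graph {k} T 1<k ω n₀ =
    -- The voltages are taken modulo `suc n₀`, and every residue occurs as a value in the component.
    -- One pair of different labels serves on both sides of the 4-cycle.
    n , ℕₚ.≤-trans (ℕₚ.n≤1+n n₀)
          (size-≥ (value T ω≢ω′ ω≢ω′) λ y → let _ , s , eq = reachable-value T ω≢ω′ ω≢ω′ y in _ , s , eq)
    , labelledComponent , connectedᶜ , at ε , cong index (ι-at ε)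
    where
    open Cover k n₀
    ω≢ω′ : ω ≢ proj₁ (distinct-from 1<k ω)
    ω≢ω′ = proj₂ (distinct-from 1<k ω)
    open Component T (cover T) (enumCell k n₀) _≟-Cell_ (base T ω≢ω′ ω≢ω′)

-- The lexicographic product of Λ with the edgeless graph on Fin m

does-true : ∀ {P : Set} (p? : Dec P) → does p? ≡ true → P
does-true (yes p) _ = p

finToFun-injective : ∀ {m n} {i j : Fin (m ^ n)} → (∀ x → finToFun {m} {n} i x ≡ finToFun j x) → i ≡ j
finToFun-injective {m} {n} {i} {j} eq = trans (sym (funToFin-finToFin {n} {m} i))
  (trans (funToFin-cong eq) (funToFin-finToFin {n} {m} j))
  where
  funToFin-cong : ∀ {m n} {f g : Fin m → Fin n} → (∀ x → f x ≡ g x) → funToFin f ≡ funToFin g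
  funToFin-cong {zero}  eq = refl
  funToFin-cong {suc m} eq = cong₂ combine (eq zero) (funToFin-cong (eq ∘ suc))

module Lexicographic {m k n} (R : PermGroup m) (T : PermGroup k)
                     (R-transitive : Transitive R) (T-transitive : Transitive T)
                     (Λ : LabelledGraph T (Fin n))
                     (Λ-connected : ∀ u v → Star (LabelledGraph.Edge Λ) u v)
                     (δ₀ : Fin m) (x₀ : Fin n) where

  open LabelledGraph Λ
  open LocallyIn

  N : ℕ
  N = m * n

  opaque

    fibre : Fin N → Fin m
    fibre u = proj₁ (remQuot {m} n u)

    base : Fin N → Fin n
    base u = proj₂ (remQuot {m} n u)

    base-combine : ∀ (δ : Fin m) (x : Fin n) → base (combine δ x) ≡ x
    base-combine δ x = cong proj₂ (remQuot-combine {m} δ x)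

    fibre-combine : ∀ (δ : Fin m) (x : Fin n) → fibre (combine δ x) ≡ δ
    fibre-combine δ x = cong proj₁ (remQuot-combine {m} δ x)

    combine-fibre-base : ∀ u → combine (fibre u) (base u) ≡ u
    combine-fibre-base u = combine-remQuot {m} n u

  β : Fin N → Fin m × Fin k → Fin N
  β u (δ , ω) = combine δ (nbr (base u) ω)

  nbr-injective : ∀ x i j → nbr x i ≡ nbr x j → i ≡ j
  nbr-injective x i j eq = trans (sym (index-nbr x i)) (trans (cong index eq) (index-nbr x j))

  β-injective : ∀ u x y → β u x ≡ β u y → x ≡ y
  β-injective u (δ , i) (δ′ , j) eq with refl , nbr≡ ← combine-injective δ _ δ′ _ eq
    = cong (δ ,_) (nbr-injective _ i j nbr≡)

  edge? : ∀ x y → Dec (Edge x y)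
  edge? x y = any? λ j → nbr x j Finₚ.≟ y

  β-edge : ∀ u x → Edge (base u) (base (β u x))
  β-edge u (δ , j) = j , sym (base-combine δ _)

  edge-β : ∀ u v → Edge (base u) (base v) → ∃ λ x → β u x ≡ v
  edge-β u v (j , eq) = (fibre v , j) , trans (cong (combine (fibre v)) eq) (combine-fibre-base v)

  adjacent : Fin N → Fin N → Bool
  adjacent u v = does (edge? (base u) (base v))

  β-adjacent : ∀ u x → adjacent u (β u x) ≡ true
  β-adjacent u x = dec-true (edge? _ _) (β-edge u x)

  adjacent-β : ∀ u v → adjacent u v ≡ true → ∃ λ x → β u x ≡ v
  adjacent-β u v u~v = edge-β u v (does-true (edge? _ _) u~v)

  lift-walk : ∀ {x y} u v → Edge (base u) x → Star Edge x y → y ≡ base v → Walk adjacent u v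
  lift-walk u v e ε refl = step (dec-true (edge? _ _) e) here
  lift-walk {x} u v e (e′ ◅ s) y≡v = step {w = combine (fibre v) x}
    (dec-true (edge? _ _) (subst (Edge (base u)) (sym (base-combine _ x)) e))
    (lift-walk _ v (subst (λ z → Edge z _) (sym (base-combine _ x)) e′) s y≡v)

  -- Vertices of one fibre are not adjacent, so an empty walk in Λ cannot be lifted to a change of
  -- fibre. Stepping to a neighbour and returning first makes the walk in Λ non-empty, and its last
  -- edge can then end anywhere in the target fibre.
  walks : ∀ u v → Walk adjacent u v
  walks u v = step (β-adjacent u x)
    (lift-walk (β u x) v (edge-sym (β-edge u x)) (Λ-connected (base u) (base v)) refl)
    where
    x : Fin m × Fin k
    x = fibre u , index (base u)

  Γ : Graph N
  Γ = record
    { adj       = adjacent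
    ; symmetric = λ u v → does-⇔ (mk⇔ edge-sym edge-sym) (edge? _ _) (edge? _ _)
    ; irreflex  = λ u → dec-false (edge? _ _) λ (j , eq) → loopless _ j eq
    ; nonempty  = ℕₚ.≤-<-trans z≤n (toℕ<n (combine δ₀ x₀))
    ; connected = walks
    }

  -- The group of all permutations with local action in R≀T

  L : (Fin m × Fin k → Fin m × Fin k) → Set
  L = InWreath R T

  -- A decidable form of `ActsLocally`: for fixed `b` the components of the base group element can
  -- be chosen separately for each `ω`, so the search runs through group elements instead of
  -- functions into R.
  Legal : Perm N → Set
  Legal p = IsPerm p × ∀ u → Any (λ b → ∀ ω → Any (λ a → ∀ δ →
    app p (β u (δ , ω)) ≡ β (app p u) (app a δ , app b ω)) (elems R)) (elems T)

  legal? : Decidable Legal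
  legal? p = all? (λ i → all? λ j → (app p i Finₚ.≟ app p j) →-dec (i Finₚ.≟ j)) ×-dec
    all? λ u → Any.any? (λ b → all? λ ω → Any.any? (λ a → all? λ δ →
      app p (β u (δ , ω)) Finₚ.≟ β (app p u) (app a δ , app b ω)) (elems R)) (elems T)

  ActsLocally : Perm N → Set
  ActsLocally p = ∀ u → ∃ λ σ → L σ × ∀ x → app p (β u x) ≡ β (app p u) (σ x)

  legal-acts : ∀ p → Legal p → ActsLocally p
  legal-acts p (_ , local) u with b , b∈ , coset ← find (local u) =
    (λ (δ , ω) → app (a ω) δ , app b ω)
    , (a , b , (λ ω → proj₁ (proj₂ (find (coset ω)))) , b∈ , λ _ _ → refl)
    , λ (δ , ω) → proj₂ (proj₂ (find (coset ω))) δ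
    where
    a : Fin k → Perm m
    a ω = proj₁ (find (coset ω))

  acts-legal : ∀ p → IsPerm p → ActsLocally p → Legal p
  acts-legal p p-perm acts = p-perm , λ u →
    let σ , (a , b , a∈ , b∈ , σ≡) , eq = acts u in
    lose b∈ λ ω → lose (a∈ ω) λ δ → trans (eq (δ , ω)) (cong (β (app p u)) (σ≡ δ ω))

  L-∘ : ∀ {σ τ} → L σ → L τ → L (τ ∘ σ)
  L-∘ {τ = τ} (a , b , a∈ , b∈ , σ≡) (a′ , b′ , a′∈ , b′∈ , τ≡) =
    (λ ω → comp (a ω) (a′ (app b ω))) , comp b b′
    , (λ ω → closed R (a∈ ω) (a′∈ (app b ω))) , closed T b∈ b′∈
    , λ δ ω → trans (cong τ (σ≡ δ ω)) (trans (τ≡ _ _)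
        (sym (cong₂ _,_ (app-comp (a ω) (a′ (app b ω)) δ) (app-comp b b′ ω))))

  L-id : L id
  L-id = (λ _ → idPerm) , idPerm , (λ _ → hasId R) , hasId T
       , λ δ ω → sym (cong₂ _,_ (app-id δ) (app-id ω))

  L-surjective : ∀ {σ} → L σ → ∀ y → ∃ λ x → σ x ≡ y
  L-surjective (a , b , a∈ , b∈ , σ≡) (δ , ω)
    with i , refl ← fin-injective⇒surjective (∈-isPerm T b∈) ω
    with d , refl ← fin-injective⇒surjective (∈-isPerm R (a∈ i)) δ
    = (d , i) , σ≡ d i

  permutations : List (Perm N)
  permutations = filter legal? (elements (enumVec (enumFin N) N))

  ∈-permutations : ∀ {p} → IsPerm p → ActsLocally p → p ∈ permutations
  ∈-permutations {p} p-perm acts =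
    ∈-filter⁺ legal? (complete (enumVec (enumFin N) N) _) (acts-legal p p-perm acts)

  permutations-legal : ∀ {p} → p ∈ permutations → Legal p
  permutations-legal p∈ = proj₂ (∈-filter⁻ legal? {xs = elements (enumVec (enumFin N) N)} p∈)

  permutations-act : ∀ {p} → p ∈ permutations → ActsLocally p
  permutations-act {p} p∈ = legal-acts p (permutations-legal p∈)

  G : PermGroup N
  G = record
    { elems  = permutations
    ; unique = Uniqueₚ.filter⁺ legal? (distinct (enumVec (enumFin N) N))
    ; perms  = All.tabulate λ p∈ → proj₁ (permutations-legal p∈)
    ; hasId  = ∈-permutations
        (λ i j eq → trans (sym (app-id i)) (trans eq (app-id j)))
        (λ u → id , L-id , λ x → trans (app-id _) (cong (λ v → β v x) (sym (app-id u))))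
    ; closed = λ {p} {q} p∈ q∈ → ∈-permutations
        (λ i j eq → proj₁ (permutations-legal p∈) i j (proj₁ (permutations-legal q∈) _ _
          (trans (sym (app-comp p q i)) (trans eq (app-comp p q j)))))
        (λ u →
          let σ , σ∈ , p-local = permutations-act p∈ u
              τ , τ∈ , q-local = permutations-act q∈ (app p u)
          in τ ∘ σ , L-∘ σ∈ τ∈ , λ x → begin
            app (comp p q) (β u x)              ≡⟨ app-comp p q _ ⟩
            app q (app p (β u x))               ≡⟨ cong (app q) (p-local x) ⟩
            app q (β (app p u) (σ x))           ≡⟨ q-local (σ x) ⟩
            β (app q (app p u)) (τ (σ x))       ≡⟨ cong (λ v → β v (τ (σ x))) (app-comp p q u) ⟨
            β (app (comp p q) u) (τ (σ x))      ∎)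
    }
    where open ≡-Reasoning

  G-automorphisms : IsAutGroup Γ G
  G-automorphisms g g∈ u v = does-⇔ (mk⇔ back forth) (edge? _ _) (edge? _ _)
    where
    acts : ∃ λ σ → L σ × ∀ x → app g (β u x) ≡ β (app g u) (σ x)
    acts = permutations-act g∈ u

    -- The local permutation is surjective, so each neighbour of the image of `u` is the image of a
    -- neighbour of `u`; injectivity of `g` identifies that neighbour with `v`.
    back : Edge (base (app g u)) (base (app g v)) → Edge (base u) (base v)
    back e with y , βy≡gv ← edge-β (app g u) (app g v) e
           with σ , σ∈ , local ← acts
           with x , refl ← L-surjective σ∈ y
      = subst (Edge (base u) ∘ base) (proj₁ (permutations-legal g∈) _ _ (trans (local x) βy≡gv)) (β-edge u x)

    forth : Edge (base u) (base v) → Edge (base (app g u)) (base (app g v))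
    forth e with x , refl ← edge-β u v e
            with σ , _ , local ← acts
      = subst (Edge (base (app g u)) ∘ base) (sym (local x)) (β-edge (app g u) (σ x))

  -- Lifting automorphisms of Λ

  opaque

    lift : (Fin n → Perm m) → (Fin n → Fin n) → Perm N
    lift A h = tabulate λ u → combine (app (A (base u)) (fibre u)) (h (base u))

    app-lift : ∀ A h u → app (lift A h) u ≡ combine (app (A (base u)) (fibre u)) (h (base u))
    app-lift A h u = lookup∘tabulate _ u

  app-lift-combine : ∀ A h δ x → app (lift A h) (combine δ x) ≡ combine (app (A x) δ) (h x)
  app-lift-combine A h δ x = trans (app-lift A h _)
    (cong₂ (λ y d → combine (app (A y) d) (h y)) (base-combine δ x) (fibre-combine δ x))

  lift-∈ : ∀ A h → (∀ x → A x ∈ elems R) → LocallyIn T nbr h → lift A h ∈ elems G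
  lift-∈ A h A∈ legal = ∈-permutations lift-perm lift-acts
    where
    lift-perm : IsPerm (lift A h)
    lift-perm u v eq with d≡ , h≡ ← combine-injective _ _ _ _
        (trans (sym (app-lift A h u)) (trans eq (app-lift A h v)))
      = trans (sym (combine-fibre-base u)) (trans (cong₂ combine fibre≡ base≡) (combine-fibre-base v))
      where
      base≡ : base u ≡ base v
      base≡ = injective legal _ _ h≡
      fibre≡ : fibre u ≡ fibre v
      fibre≡ = ∈-isPerm R (A∈ (base u)) _ _ (trans d≡ (cong (λ x → app (A x) (fibre v)) (sym base≡)))

    lift-acts : ActsLocally (lift A h)
    lift-acts u with b , b∈ , local-h ← local legal (base u) =
      (λ (δ , ω) → app (A (nbr (base u) ω)) δ , app b ω)
      , ((λ ω → A (nbr (base u) ω)) , b , (λ ω → A∈ _) , b∈ , λ _ _ → refl)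
      , λ (δ , ω) → trans (app-lift-combine A h δ _) (cong (combine (app (A (nbr (base u) ω)) δ)) (trans (local-h ω)
          (cong (λ x → nbr x (app b ω)) (sym (trans (cong base (app-lift A h u)) (base-combine _ _))))))

  -- The elements of R may be chosen independently over different vertices of Λ: `t` over `base u`
  -- moves `u` within its fibre, and over the neighbour with label `ω` the component `a ω` is found
  -- through `index`. Looplessness keeps the two choices apart. Both arc-transitivity and the
  -- fullness of the local action follow.
  flag-transitive : ∀ u v {σ} → L σ →
    ∃ λ g → g ∈ elems G × app g u ≡ v × (∀ x → app g (β u x) ≡ β v (σ x))
  flag-transitive u v {σ} (a , b , a∈ , b∈ , σ≡)
    with s , s∈ , s≡ ← T-transitive (index (base u)) (index (base v))
    with t , t∈ , t≡ ← R-transitive (fibre u) (fibre v)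
    with h , legal , hu≡v , near , _ ← automorphism (base u) (base v) s∈ b∈ s≡
    = lift A h , lift-∈ A h A∈ legal
    , trans (app-lift A h u)
        (trans (cong₂ combine (trans (cong (λ p → app p (fibre u)) A-base) t≡) hu≡v) (combine-fibre-base v))
    , λ (δ , ω) → begin
        app (lift A h) (β u (δ , ω))
          ≡⟨ app-lift-combine A h δ _ ⟩
        combine (app (A (nbr (base u) ω)) δ) (h (nbr (base u) ω))
          ≡⟨ cong₂ (λ p y → combine (app p δ) y) (A-nbr ω) (near ω) ⟩
        combine (app (a ω) δ) (nbr (base v) (app b ω))
          ≡⟨ cong (β v) (σ≡ δ ω) ⟨
        β v (σ (δ , ω)) ∎
    where
    open ≡-Reasoning
    A : Fin n → Perm m
    A y with y Finₚ.≟ base u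
    ... | yes _ = t
    ... | no  _ = a (index y)

    A∈ : ∀ y → A y ∈ elems R
    A∈ y with y Finₚ.≟ base u
    ... | yes _ = t∈
    ... | no  _ = a∈ (index y)

    A-base : A (base u) ≡ t
    A-base with base u Finₚ.≟ base u
    ... | yes _ = refl
    ... | no ¬refl = contradiction refl ¬refl

    A-nbr : ∀ ω → A (nbr (base u) ω) ≡ a ω
    A-nbr ω with nbr (base u) ω Finₚ.≟ base u
    ... | yes loop = contradiction loop (loopless _ ω)
    ... | no _ = cong a (index-nbr _ ω)

  locally-wreath : LocallyL Γ G (Fin m × Fin k) L
  locally-wreath = G-automorphisms , arc-transitive , λ v →
    β v , β-injective v , β-adjacent v , adjacent-β v
    , (λ g g∈ gv≡v → let σ , σ∈ , local = permutations-act g∈ v in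
         σ , σ∈ , λ x → trans (local x) (cong (λ w → β w (σ x)) gv≡v))
    , λ σ σ∈ → flag-transitive v v σ∈
    where
    arc-transitive : ArcTransitive Γ G
    arc-transitive u v x y u~v x~y
      with (δ , ω) , refl ← adjacent-β u v u~v
      with (δ′ , ω′) , refl ← adjacent-β x y x~y
      with t , t∈ , refl ← R-transitive δ δ′
      with b , b∈ , refl ← T-transitive ω ω′
      with g , g∈ , gu≡x , local ← flag-transitive u x {λ (d , i) → app t d , app b i}
             ((λ _ → t) , b , (λ _ → t∈) , b∈ , λ _ _ → refl)
      = g , g∈ , gu≡x , local (δ , ω)

  -- A lower bound for the arc stabiliser

  ω₀ : Fin k
  ω₀ = index x₀

  -- The neighbour whose label equals the index of `x₀`, so that one point stabiliser of T serves at
  -- both ends of the arc.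
  y₀ : Fin n
  y₀ = nbr x₀ ω₀

  to-δ₀ : Fin m → Perm m
  to-δ₀ d = proj₁ (R-transitive d δ₀)

  Endpoint : Fin n → Set
  Endpoint y = y ≡ x₀ ⊎ y ≡ y₀

  endpoint? : Decidable Endpoint
  endpoint? y = (y Finₚ.≟ x₀) ⊎-dec (y Finₚ.≟ y₀)

  -- Moves a base group element into the stabiliser of δ₀ over the two ends of the arc.
  correct : (Fin n → Perm m) → Fin n → Perm m
  correct A y with endpoint? y
  ... | yes _ = comp (A y) (to-δ₀ (app (A y) δ₀))
  ... | no  _ = A y

  correct-∈ : ∀ {A} → (∀ y → A y ∈ elems R) → ∀ y → correct A y ∈ elems R
  correct-∈ A∈ y with endpoint? y
  ... | yes _ = closed R (A∈ y) (proj₁ (proj₂ (R-transitive _ δ₀)))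
  ... | no  _ = A∈ y

  correct-fixes : ∀ A y → Endpoint y → app (correct A y) δ₀ ≡ δ₀
  correct-fixes A y end with endpoint? y
  ... | yes _ = trans (app-comp (A y) (to-δ₀ (app (A y) δ₀)) δ₀)
    (proj₂ (proj₂ (R-transitive (app (A y) δ₀) δ₀)))
  ... | no ¬end = contradiction end ¬end

  -- The correction depends only on the image of `δ₀`. If these images agree, the same permutation
  -- has been appended on both sides and cancels.
  correct-injective : ∀ A B y → (Endpoint y → app (A y) δ₀ ≡ app (B y) δ₀) →
                      correct A y ≡ correct B y → A y ≡ B y
  correct-injective A B y same eq with endpoint? y
  ... | no _ = eq
  ... | yes end = lookup-ext λ d → ∈-isPerm R (proj₁ (proj₂ (R-transitive (app (A y) δ₀) δ₀))) _ _ (begin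
      app (to-δ₀ (app (A y) δ₀)) (app (A y) d)    ≡⟨ app-comp (A y) (to-δ₀ (app (A y) δ₀)) d ⟨
      app (comp (A y) (to-δ₀ (app (A y) δ₀))) d   ≡⟨ cong (λ p → app p d) eq ⟩
      app (comp (B y) (to-δ₀ (app (B y) δ₀))) d   ≡⟨ app-comp (B y) (to-δ₀ (app (B y) δ₀)) d ⟩
      app (to-δ₀ (app (B y) δ₀)) (app (B y) d)    ≡⟨ cong (λ e → app (to-δ₀ e) (app (B y) d)) (same end) ⟨
      app (to-δ₀ (app (A y) δ₀)) (app (B y) d)    ∎)
    where open ≡-Reasoning

  u₀ v₀ : Fin N
  u₀ = combine δ₀ x₀
  v₀ = combine δ₀ y₀

  u₀~v₀ : adjacent u₀ v₀ ≡ true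
  u₀~v₀ = dec-true (edge? _ _) (ω₀ , trans (cong (λ x → nbr x ω₀) (base-combine δ₀ x₀)) (sym (base-combine δ₀ y₀)))

  Tω : Set
  Tω = Fin (stabOrder T ω₀)

  elt : Tω → Perm k
  elt = stabiliser-element T ω₀ ω₀

  elt∈ : ∀ s → elt s ∈ elems T
  elt∈ s = proj₁ (stabiliser-element∈ T ω₀ ω₀ s)

  elt-fixes : ∀ s → app (elt s) ω₀ ≡ ω₀
  elt-fixes s = proj₁ (proj₂ (stabiliser-element∈ T ω₀ ω₀ s))

  module _ (s t : Tω) where

    private
      top-data = automorphism x₀ x₀ (elt∈ s) (elt∈ t) (elt-fixes s)

    top : Fin n → Fin n
    top = proj₁ top-data

    top-legal : LocallyIn T nbr top
    top-legal = proj₁ (proj₂ top-data)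

    top-x₀ : top x₀ ≡ x₀
    top-x₀ = proj₁ (proj₂ (proj₂ top-data))

    top-nbr : ∀ j → top (nbr x₀ j) ≡ nbr x₀ (app (elt t) j)
    top-nbr = proj₁ (proj₂ (proj₂ (proj₂ top-data)))

    top-nbr-y₀ : ∀ i → top (nbr y₀ i) ≡ nbr y₀ (app (elt s) i)
    top-nbr-y₀ i = trans (proj₂ (proj₂ (proj₂ (proj₂ top-data))) ω₀ i)
      (cong (λ j → nbr (nbr x₀ j) (app (elt s) i)) (elt-fixes t))

    top-y₀ : top y₀ ≡ y₀
    top-y₀ = trans (top-nbr ω₀) (cong (nbr x₀) (elt-fixes t))

  -- The action on the neighbours of `x₀` reveals `t`, and the action on the neighbours of `y₀`
  -- reveals `s`.
  top-injective : ∀ {s t s′ t′} → (∀ x → top s t x ≡ top s′ t′ x) → s ≡ s′ × t ≡ t′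
  top-injective {s} {t} {s′} {t′} eq =
      stabiliser-element-injective T ω₀ ω₀ (lookup-ext λ i → nbr-injective y₀ _ _
        (trans (sym (top-nbr-y₀ s t i)) (trans (eq _) (top-nbr-y₀ s′ t′ i))))
    , stabiliser-element-injective T ω₀ ω₀ (lookup-ext λ i → nbr-injective x₀ _ _
        (trans (sym (top-nbr s t i)) (trans (eq _) (top-nbr s′ t′ i))))

  BaseGroup : Set
  BaseGroup = Fin n → Fin (order R)

  bottom : BaseGroup → Fin n → Perm m
  bottom f y = element R (f y)

  stab : Tω → Tω → BaseGroup → Perm N
  stab s t f = lift (correct (bottom f)) (top s t)

  stab-∈ : ∀ s t f → stab s t f ∈ elems G
  stab-∈ s t f = lift-∈ _ _ (correct-∈ (λ y → ∈-lookup (f y))) (top-legal s t)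

  stab-fixes : ∀ s t f → Fixes₂ u₀ v₀ (stab s t f)
  stab-fixes s t f =
      trans (app-lift-combine _ _ δ₀ x₀) (cong₂ combine (correct-fixes (bottom f) x₀ (inj₁ refl)) (top-x₀ s t))
    , trans (app-lift-combine _ _ δ₀ y₀) (cong₂ combine (correct-fixes (bottom f) y₀ (inj₂ refl)) (top-y₀ s t))

  stab-injective : ∀ {s t f s′ t′ f′} → stab s t f ≡ stab s′ t′ f′ →
    app (bottom f x₀) δ₀ ≡ app (bottom f′ x₀) δ₀ → app (bottom f y₀) δ₀ ≡ app (bottom f′ y₀) δ₀ →
    s ≡ s′ × t ≡ t′ × (∀ y → f y ≡ f′ y)
  stab-injective {s} {t} {f} {s′} {t′} {f′} eq at-x₀ at-y₀ =
    let s≡ , t≡ = top-injective {s} {t} {s′} {t′} (λ x → proj₂ (same δ₀ x)) in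
    s≡ , t≡ , λ y → lookup-injective (unique R)
      (correct-injective (bottom f) (bottom f′) y (λ { (inj₁ refl) → at-x₀ ; (inj₂ refl) → at-y₀ })
        (lookup-ext λ d → proj₁ (same d y)))
    where
    same : ∀ d y → app (correct (bottom f) y) d ≡ app (correct (bottom f′) y) d × top s t y ≡ top s′ t′ y
    same d y = combine-injective _ _ _ _ (trans (sym (app-lift-combine _ _ d y))
      (trans (cong (λ p → app p (combine d y)) eq) (app-lift-combine _ _ d y)))

  stab-order-≥ : stabOrder T ω₀ * stabOrder T ω₀ * order R ^ n ≤ stab2Order G u₀ v₀ * (m * m)
  stab-order-≥ = injective⇒≤ {f = encode} λ {i} {j} eq →
    let g≡ , d≡ = combine-injective _ _ _ _ eq
        dx≡ , dy≡ = combine-injective _ _ _ _ d≡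
        s≡ , t≡ , f≡ = stab-injective {proj₁ (st i)} {proj₂ (st i)} {fs i}
          (stabiliser-index-cancel G u₀ v₀ (stab-∈ _ _ (fs i)) (stab-∈ _ _ (fs j))
            (stab-fixes _ _ (fs i)) (stab-fixes _ _ (fs j)) g≡) dx≡ dy≡
    in decode-injective i j s≡ t≡ f≡
    where
    a = stabOrder T ω₀
    r = order R

    st : Fin (a * a * r ^ n) → Tω × Tω
    st i = remQuot a (proj₁ (remQuot {a * a} (r ^ n) i))

    fs : Fin (a * a * r ^ n) → BaseGroup
    fs i = finToFun (proj₂ (remQuot {a * a} (r ^ n) i))

    decode-injective : ∀ i j → proj₁ (st i) ≡ proj₁ (st j) → proj₂ (st i) ≡ proj₂ (st j) →
                       (∀ y → fs i y ≡ fs j y) → i ≡ j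
    decode-injective i j s≡ t≡ f≡ = begin
      i                                              ≡⟨ combine-remQuot {a * a} (r ^ n) i ⟨
      uncurry combine (remQuot {a * a} (r ^ n) i)    ≡⟨ cong₂ combine st≡ fs≡ ⟩
      uncurry combine (remQuot {a * a} (r ^ n) j)    ≡⟨ combine-remQuot {a * a} (r ^ n) j ⟩
      j                                              ∎
      where
      open ≡-Reasoning
      st≡ = trans (sym (combine-remQuot {a} a _)) (trans (cong₂ combine s≡ t≡) (combine-remQuot {a} a _))
      fs≡ = finToFun-injective f≡

    -- The factor m * m keeps the two images of δ₀ that the correction forgets.
    encode : Fin (a * a * r ^ n) → Fin (stab2Order G u₀ v₀ * (m * m))
    encode i = combine
      (stabiliser-index G u₀ v₀ (stab-∈ _ _ (fs i)) (stab-fixes (proj₁ (st i)) (proj₂ (st i)) (fs i)))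
      (combine (app (bottom (fs i) x₀) δ₀) (app (bottom (fs i) y₀) δ₀))

-- The growth of the arc stabilisers

module _ {m k} (R : PermGroup m) (T : PermGroup k)
         (R-transitive : Transitive R) (T-transitive : Transitive T)
         (1<|R| : 1 < order R) (1<|T| : 1 < order T) where

  private
    δ₀ : Fin m
    δ₀ = fromℕ< (≤-trans (s≤s z≤n) (degree>1 R 1<|R|))

  opaque

    large-stabilisers : ∀ ω n₀ → ∃ λ n → n₀ ≤ n × Σ (Graph (m * n)) λ Γ → Σ (PermGroup (m * n)) λ G →
      LocallyL Γ G (Fin m × Fin k) (InWreath R T) ×
      ∃₂ λ u v → adj Γ u v ≡ true ×
        stabOrder T ω * stabOrder T ω * order R ^ n ≤ stab2Order G u v * (m * m)
    large-stabilisers ω n₀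
      with n , n₀≤n , Λ , connected , x₀ , refl ← large-labelled-graph T (degree>1 T 1<|T|) ω n₀
      = n , n₀≤n , Γ , G , locally-wreath , u₀ , v₀ , u₀~v₀ , stab-order-≥
      where open Lexicographic R T R-transitive T-transitive Λ connected δ₀ x₀

  private
    instance
      m≢0 : NonZero m
      m≢0 = >-nonZero (≤-trans (s≤s z≤n) (degree>1 R 1<|R|))

  -- The graph has m·n vertices, so the exponent N/m is `n`; the required inequality is the m-th
  -- power of the bound on the stabiliser.
  wreath-unrestrictive : ∀ ω →
    UnrestrictiveWreathBound (Fin m × Fin k) (InWreath R T) (stabOrder T ω) (order R) m
  wreath-unrestrictive ω n₀ with n , n₀≤n , Γ , G , locally , u , v , u~v , bound ← large-stabilisers ω n₀ =
    m * n , Γ , G , locally , ≤-trans n₀≤n (m≤n*m n m) , u , v , u~v , (begin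
      a ^ (2 * m) * r ^ (m * n)      ≡⟨ cong₂ _*_ (sym (square-^ a)) (trans (cong (r ^_) (*-comm m n)) (sym (^-*-assoc r n m))) ⟩
      (a * a) ^ m * (r ^ n) ^ m      ≡⟨ *-^-distrib (a * a) (r ^ n) m ⟨
      (a * a * r ^ n) ^ m            ≤⟨ ^-monoˡ-≤ m bound ⟩
      (s * (m * m)) ^ m              ≡⟨ *-^-distrib s (m * m) m ⟩
      s ^ m * (m * m) ^ m            ≡⟨ cong (s ^ m *_) (square-^ m) ⟩
      s ^ m * m ^ (2 * m)            ∎)
    where
    open ≤-Reasoning
    a = stabOrder T ω
    r = order R
    s = stab2Order G u v
    square-^ : ∀ b → (b * b) ^ m ≡ b ^ (2 * m)
    square-^ b = trans (cong (_^ m) (cong (b *_) (sym (*-identityʳ b)))) (^-*-assoc b 2 m)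

  wreath-exp-unrestrictive : ExpUnrestrictive (Fin m × Fin k) (InWreath R T)
  wreath-exp-unrestrictive = suc q , q , 0<q , ≤-refl , λ n₀ →
    -- The term `4 * m` makes `n` large enough for the divisor m² to cost at most half of the
    -- exponent.
    let n , n₀≤n , Γ , G , locally , u , v , u~v , bound = large-stabilisers ω (n₀ ⊔ 4 * m) in
    m * n , Γ , G , locally , ≤-trans (m≤m⊔n n₀ (4 * m)) (≤-trans n₀≤n (m≤n*m n m)) , u , v , u~v ,
    exponential-bound m n (stab2Order G u v) q 1+q≡4m (≤-trans (m≤n⊔m n₀ (4 * m)) n₀≤n) (begin
      2 ^ n                                            ≤⟨ ^-monoˡ-≤ n 1<|R| ⟩
      order R ^ n                                      ≡⟨ *-identityˡ _ ⟨
      1 * 1 * order R ^ n                              ≤⟨ *-monoˡ-≤ (order R ^ n) (*-mono-≤ 1≤|Tω| 1≤|Tω|) ⟩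
      stabOrder T ω * stabOrder T ω * order R ^ n      ≤⟨ bound ⟩
      stab2Order G u v * (m * m)                       ∎)
    where
    open ≤-Reasoning
    ω : Fin k
    ω = fromℕ< (≤-trans (s≤s z≤n) (degree>1 T 1<|T|))

    1≤|Tω| : 1 ≤ stabOrder T ω
    1≤|Tω| = ≤-trans (s≤s z≤n) (Finₚ.toℕ<n
      (stabiliser-index T ω ω (hasId T) (app-id ω , app-id ω)))

    -- The base of the exponential is 4m/(4m-1): its power 2m is at most 2, so over m·n vertices it
    -- grows at most like 2^(n/2).
    q : ℕ
    q = 2 * (2 * m) ∸ 1

    4≤4m : 2 * (2 * 1) ≤ 2 * (2 * m)
    4≤4m = *-monoʳ-≤ 2 (*-monoʳ-≤ 2 (≤-trans (s≤s z≤n) (degree>1 R 1<|R|)))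

    1+q≡4m : suc q ≡ 2 * (2 * m)
    1+q≡4m = m+[n∸m]≡n (≤-trans (s≤s z≤n) 4≤4m)

    0<q : 0 < q
    0<q = ∸-monoˡ-≤ 1 (≤-trans (s≤s (s≤s z≤n)) 4≤4m)

theorem3p2 : ∀ (m k : ℕ) (R : PermGroup m) (T : PermGroup k) →
    Transitive R → Transitive T → 1 < order R → 1 < order T →
    (∀ (ω : Fin k) →
    UnrestrictiveWreathBound (Fin m × Fin k) (InWreath R T)
    (stabOrder T ω) (order R) m)
    × GraphTypeExp (Fin m × Fin k) (InWreath R T)
theorem3p2 m k R T R-transitive T-transitive 1<|R| 1<|T| =
  wreath-unrestrictive R T R-transitive T-transitive 1<|R| 1<|T|
  , exp-restrictive m k (InWreath R T)
  , wreath-exp-unrestrictive R T R-transitive T-transitive 1<|R| 1<|T|
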